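{- Let $d\geq 3$, let $q$ be a prime power, let $t\in\mathbb{F}_q$ be nonzero, and let $E\subseteq\mathbb{F}_q^d$. There is a constant $C_d$ depending only on $d$ such that if $|E|\geq C_d\,q^{d-\frac{1}{d-1}}$ and $q$ is sufficiently large, then the VC-dimension of $\mathcal{H}_t(E)$ is equal to $d$.
   Context: For $x,y\in\mathbb{F}_q^d$, $x\cdot y=x_1y_1+\cdots+x_dy_d$. For $E\subseteq\mathbb{F}_q^d$ and nonzero $t\in\mathbb{F}_q$, $\mathcal{H}_t(E)=\{h_y: y\in E\}$, where $h_y:E\to\{0,1\}$ is given by $h_y(x)=1$ if and only if $x\cdot y=t$. A collection $\mathcal{H}$ of functions $X\to\{0,1\}$ shatters a finite set $C\subseteq X$ if the restrictions of the functions in $\mathcal{H}$ to $C$ give every function $C\to\{0,1\}$. The VC-dimension of $\mathcal{H}$ is the largest $n$ such that some subset of $X$ of size $n$ is shattered by $\mathcal{H}$ (here $X=E$). -}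

module Defs where

open import Data.Nat using (ℕ; _^_; _≤_)
open import Data.Nat.Primality using (Prime)
open import Data.Bool using (Bool)
open import Data.Product using (Σ; ∃; _×_; _,_)
open import Data.List using (List; length)
open import Data.List.Membership.Propositional using (_∈_)
open import Data.List.Relation.Unary.Unique.Propositional using (Unique)
open import Data.List.Relation.Unary.All using (All)
open import Data.Vec using (Vec; foldr; zipWith)
open import Data.Empty using (⊥)
open import Relation.Nullary using (¬_; does)
open import Relation.Binary.PropositionalEquality using (_≡_)
open import Relation.Binary.Definitions using (DecidableEquality)
open import Algebra.Structures using (IsCommutativeRing)

IsPrimePower : ℕ → Set
IsPrimePower q = Σ ℕ λ p → Σ ℕ λ k → Prime p × (1 ≤ k) × (q ≡ p ^ k)

record FiniteField : Set₁ where
  infixl 6 _+_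
  infixl 7 _*_
  field
    Carrier   : Set
    _+_ _*_   : Carrier → Carrier → Carrier
    -_        : Carrier → Carrier
    0# 1#     : Carrier
    isCommutativeRing : IsCommutativeRing _≡_ _+_ _*_ -_ 0# 1#
    0≢1       : ¬ (0# ≡ 1#)
    inverse   : ∀ x → ¬ (x ≡ 0#) → Σ Carrier λ y → x * y ≡ 1#
    _≟_       : DecidableEquality Carrier
    elements  : List Carrier
    complete  : ∀ x → x ∈ elements
    distinct  : Unique elements

  size : ℕ
  size = length elements

module _ (𝔽 : FiniteField) where
  open FiniteField 𝔽

  dot : ∀ {d} → Vec Carrier d → Vec Carrier d → Carrier
  dot x y = foldr _ _+_ 0# (zipWith _*_ x y)

  h : ∀ {d} → Carrier → Vec Carrier d → Vec Carrier d → Bool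
  h t y x = does (dot x y ≟ t)

  Shatters : ∀ {d} → Carrier → List (Vec Carrier d) → List (Vec Carrier d) → Set
  Shatters t E C = (f : Vec Carrier _ → Bool) →
    Σ (Vec Carrier _) λ y → (y ∈ E) × All (λ x → h t y x ≡ f x) C

  VCdimEq : ∀ {d} → Carrier → List (Vec Carrier d) → ℕ → Set
  VCdimEq {d} t E n =
    (Σ (List (Vec Carrier d)) λ C → Unique C × All (_∈ E) C × length C ≡ n × Shatters t E C)
    × (∀ (C : List (Vec Carrier d)) → Unique C → All (_∈ E) C → Shatters t E C → length C ≤ n)

{-# OPTIONS --safe #-}
-- Already |E| ≥ 2 c q^(d-1), with c depending on d only, suffices. Shrink E to size 2 q m, where m = c q^(d-2).
-- By a second-moment count at least half of the points y ∈ E lie on m of the hyperplanes x · y = t, x ∈ E.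
-- For such y choose d of these x independently at random. A pattern S ⊆ {1, …, d} with S ≠ {1, …, d} is realised by any
-- w ≠ y in E with x_i · w = t for i ∈ S, provided x_j · w ≠ t for j ∉ S. Since distinct y, w lie on at most q^(d-2)
-- common hyperplanes, the proviso fails rarely; and for each (x_i)_{i ∈ S} at most one y admits no such w,
-- so few pairs (y, x) lack w. Hence some (y, x) realises all patterns.
-- Conversely, vectors shattering C yield, for each x ∈ C, a vector orthogonal to C ∖ {x} but not to x, so
-- each element of C cuts the size of the annihilator by a factor of q.
module Submission where

open import Defs
open import Algebra.Bundles using (CommutativeRing)
import Algebra.Properties.Ring as RingProperties
import Algebra.Solver.Ring.NaturalCoefficients.Default as SemiringSolver
open import Data.Bool using (Bool; true; false; not; if_then_else_)
import Data.Bool.Properties as Bool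
open import Data.List using (List; []; _∷_; _++_; length; map; filter; take; cartesianProduct; cartesianProductWith)
open import Data.List.Membership.Propositional using (_∈_; find; lose)
open import Data.List.Membership.Propositional.Properties
  using (∈-∃++; ∈-++⁺ˡ; ∈-++⁺ʳ; ∈-++⁻; ∈-map⁺; ∈-map⁻; ∈-filter⁺; ∈-filter⁻; ∈-cartesianProduct⁺; ∈-cartesianProduct⁻;
         ∈-cartesianProductWith⁺; ∈-cartesianProductWith⁻)
open import Data.List.Properties using (map-++; length-map; length-take)
open import Data.List.Relation.Unary.All using (All; []; _∷_; all?)
import Data.List.Relation.Unary.All as All
import Data.List.Relation.Unary.All.Properties as All
open import Data.List.Relation.Unary.AllPairs using ([]; _∷_)
open import Data.List.Relation.Unary.Any using (Any; here; there; any?)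
open import Data.List.Relation.Unary.Unique.Propositional using (Unique)
import Data.List.Relation.Unary.Unique.Propositional.Properties as Unique
open import Data.Nat using (ℕ; zero; suc; _≤_; _<_; _+_; _*_; _^_; _∸_; z≤n; s≤s; _≤?_; _<?_; NonZero; >-nonZero)
open import Data.Nat.ListAction using (sum)
open import Data.Nat.ListAction.Properties using (sum-++)
open import Data.Nat.Properties
open import Data.Nat.Tactic.RingSolver using (solve-∀)
open import Data.Product using (Σ; ∃; ∃₂; _×_; _,_; proj₁; proj₂)
open import Data.Sum using (inj₁; inj₂)
open import Data.Vec using (Vec; []; _∷_; zipWith; replicate; toList)
import Data.Vec as Vec
import Data.Vec.Properties as Vec
import Data.Vec.Relation.Unary.All as AllV
open import Function using (_∘_; id)
open import Relation.Binary using (DecidableEquality)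
open import Relation.Binary.PropositionalEquality
open import Relation.Nullary using (¬_; Dec; yes; no; does; contradiction; ¬?)
open import Relation.Nullary.Decidable using (_×-dec_; dec-true; dec-false; decidable-stable)
open import Relation.Unary using (Decidable)

-- Finite sums and indicators over lists.

∑ : {A : Set} → List A → (A → ℕ) → ℕ
∑ xs f = sum (map f xs)

𝟙 : {P : Set} → Dec P → ℕ
𝟙 P? = if does P? then 1 else 0

𝟙≤1 : {P : Set} (P? : Dec P) → 𝟙 P? ≤ 1
𝟙≤1 (yes _) = ≤-refl
𝟙≤1 (no _)  = z≤n

𝟙-yes : {P : Set} (P? : Dec P) → P → 𝟙 P? ≡ 1
𝟙-yes (yes _) _ = refl
𝟙-yes (no ¬p) p = contradiction p ¬p

𝟙-no : {P : Set} (P? : Dec P) → ¬ P → 𝟙 P? ≡ 0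
𝟙-no (yes p) ¬p = contradiction p ¬p
𝟙-no (no _)  _  = refl

module _ {A : Set} where

  ∑-mono : (xs : List A) {f g : A → ℕ} → (∀ {x} → x ∈ xs → f x ≤ g x) → ∑ xs f ≤ ∑ xs g
  ∑-mono []       f≤g = z≤n
  ∑-mono (x ∷ xs) f≤g = +-mono-≤ (f≤g (here refl)) (∑-mono xs (f≤g ∘ there))

  ∑-cong : (xs : List A) {f g : A → ℕ} → (∀ x → f x ≡ g x) → ∑ xs f ≡ ∑ xs g
  ∑-cong []       f≡g = refl
  ∑-cong (x ∷ xs) f≡g = cong₂ _+_ (f≡g x) (∑-cong xs f≡g)

  ∑-+ : (xs : List A) (f g : A → ℕ) → ∑ xs (λ x → f x + g x) ≡ ∑ xs f + ∑ xs g
  ∑-+ []       f g = refl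
  ∑-+ (x ∷ xs) f g rewrite ∑-+ xs f g = lemma (f x) (g x) (∑ xs f) (∑ xs g)
    where
    lemma : ∀ a b c d → a + b + (c + d) ≡ a + c + (b + d)
    lemma = solve-∀

  ∑-*ˡ : (xs : List A) (c : ℕ) (f : A → ℕ) → ∑ xs (λ x → c * f x) ≡ c * ∑ xs f
  ∑-*ˡ []       c f = sym (*-zeroʳ c)
  ∑-*ˡ (x ∷ xs) c f rewrite ∑-*ˡ xs c f = sym (*-distribˡ-+ c (f x) (∑ xs f))

  ∑-*ʳ : (xs : List A) (c : ℕ) (f : A → ℕ) → ∑ xs (λ x → f x * c) ≡ ∑ xs f * c
  ∑-*ʳ []       c f = refl
  ∑-*ʳ (x ∷ xs) c f rewrite ∑-*ʳ xs c f = sym (*-distribʳ-+ c (f x) (∑ xs f))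

  ∑-const : (xs : List A) (c : ℕ) → ∑ xs (λ _ → c) ≡ length xs * c
  ∑-const []       c = refl
  ∑-const (x ∷ xs) c = cong (c +_) (∑-const xs c)

  ∑-1 : (xs : List A) → ∑ xs (λ _ → 1) ≡ length xs
  ∑-1 xs = trans (∑-const xs 1) (*-identityʳ (length xs))

  ∑-++ : (xs ys : List A) (f : A → ℕ) → ∑ (xs ++ ys) f ≡ ∑ xs f + ∑ ys f
  ∑-++ xs ys f = trans (cong sum (map-++ f xs ys)) (sum-++ (map f xs) (map f ys))

  -- By induction, one occurrence of the head of `xs` is cut out of `ys`; uniqueness of `xs` ensures
  -- that its later elements survive the cut.
  ∑-⊆ : {xs ys : List A} (f : A → ℕ) → Unique xs → (∀ {x} → x ∈ xs → x ∈ ys) → ∑ xs f ≤ ∑ ys f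
  ∑-⊆ f [] _ = z≤n
  ∑-⊆ {x ∷ xs} f (x∉xs ∷ xs!) xs⊆ys with as , bs , refl ← ∈-∃++ (xs⊆ys (here refl)) = begin
    f x + ∑ xs f              ≤⟨ +-monoʳ-≤ (f x) (∑-⊆ f xs! xs⊆as++bs) ⟩
    f x + ∑ (as ++ bs) f      ≡⟨ cong (f x +_) (∑-++ as bs f) ⟩
    f x + (∑ as f + ∑ bs f)   ≡⟨ lemma (f x) (∑ as f) (∑ bs f) ⟩
    ∑ as f + (f x + ∑ bs f)   ≡⟨ ∑-++ as (x ∷ bs) f ⟨
    ∑ (as ++ x ∷ bs) f        ∎
    where
    open ≤-Reasoning
    lemma : ∀ a b c → a + (b + c) ≡ b + (a + c)
    lemma = solve-∀
    xs⊆as++bs : ∀ {z} → z ∈ xs → z ∈ as ++ bs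
    xs⊆as++bs z∈xs with ∈-++⁻ as (xs⊆ys (there z∈xs))
    ... | inj₁ z∈as         = ∈-++⁺ˡ z∈as
    ... | inj₂ (here refl)  = contradiction refl (All.lookup x∉xs z∈xs)
    ... | inj₂ (there z∈bs) = ∈-++⁺ʳ as z∈bs

  length-⊆ : {xs ys : List A} → Unique xs → (∀ {x} → x ∈ xs → x ∈ ys) → length xs ≤ length ys
  length-⊆ {xs} {ys} xs! xs⊆ys = subst₂ _≤_ (∑-1 xs) (∑-1 ys) (∑-⊆ (λ _ → 1) xs! xs⊆ys)

  -- The averaging principle. In `choose` it selects first a point and then a tuple.
  ∑-<⇒∃ : (xs : List A) {f g : A → ℕ} → ∑ xs f < ∑ xs g → ∃ λ x → x ∈ xs × f x < g x
  ∑-<⇒∃ (x ∷ xs) {f} {g} ∑f<∑g with f x <? g x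
  ... | yes fx<gx = x , here refl , fx<gx
  ... | no  fx≮gx with z , z∈xs , fz<gz ← ∑-<⇒∃ xs (≰⇒> λ ∑g≤∑f → <⇒≱ ∑f<∑g (+-mono-≤ (≮⇒≥ fx≮gx) ∑g≤∑f))
    = z , there z∈xs , fz<gz

  module _ {P : A → Set} (P? : Decidable P) where

    length-filter-∑ : (xs : List A) → length (filter P? xs) ≡ ∑ xs (𝟙 ∘ P?)
    length-filter-∑ []       = refl
    length-filter-∑ (x ∷ xs) with does (P? x)
    ... | true  = cong suc (length-filter-∑ xs)
    ... | false = length-filter-∑ xs

    ∑-𝟙≤1 : {xs : List A} → Unique xs → (∀ {x y} → x ∈ xs → y ∈ xs → P x → P y → x ≡ y) → ∑ xs (𝟙 ∘ P?) ≤ 1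
    ∑-𝟙≤1 [] _ = z≤n
    ∑-𝟙≤1 {x ∷ xs} (x∉xs ∷ xs!) atMostOne with P? x
    ... | no  _  = ∑-𝟙≤1 xs! λ y∈ z∈ → atMostOne (there y∈) (there z∈)
    ... | yes px = begin
      suc (∑ xs (𝟙 ∘ P?))   ≤⟨ s≤s (∑-mono xs λ y∈xs → ≤-reflexive (𝟙-no (P? _) λ py →
                                 All.lookup x∉xs y∈xs (atMostOne (here refl) (there y∈xs) px py))) ⟩
      suc (∑ xs (λ _ → 0))  ≡⟨ cong suc (trans (∑-const xs 0) (*-zeroʳ (length xs))) ⟩
      1                     ∎
      where open ≤-Reasoning

∑-swap : {A B : Set} (xs : List A) (ys : List B) (f : A → B → ℕ) →
         ∑ xs (λ x → ∑ ys (f x)) ≡ ∑ ys (λ y → ∑ xs (λ x → f x y))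
∑-swap []       ys f = sym (trans (∑-const ys 0) (*-zeroʳ (length ys)))
∑-swap (x ∷ xs) ys f = trans (cong (∑ ys (f x) +_) (∑-swap xs ys f)) (sym (∑-+ ys (f x) _))

∑-map : {A B : Set} (g : A → B) (xs : List A) (f : B → ℕ) → ∑ (map g xs) f ≡ ∑ xs (f ∘ g)
∑-map g []       f = refl
∑-map g (x ∷ xs) f = cong (f (g x) +_) (∑-map g xs f)

∑-cartesianProductWith : {A B C : Set} (c : A → B → C) (xs : List A) (ys : List B) (f : C → ℕ) →
  ∑ (cartesianProductWith c xs ys) f ≡ ∑ xs (λ x → ∑ ys (λ y → f (c x y)))
∑-cartesianProductWith c []       ys f = refl
∑-cartesianProductWith c (x ∷ xs) ys f = trans (∑-++ (map (c x) ys) _ f)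
  (cong₂ _+_ (∑-map (c x) ys f) (∑-cartesianProductWith c xs ys f))

length-cartesianProductWith : {A B C : Set} (c : A → B → C) (xs : List A) (ys : List B) →
  length (cartesianProductWith c xs ys) ≡ length xs * length ys
length-cartesianProductWith c xs ys = begin
  length (cartesianProductWith c xs ys)         ≡⟨ ∑-1 (cartesianProductWith c xs ys) ⟨
  ∑ (cartesianProductWith c xs ys) (λ _ → 1)    ≡⟨ ∑-cartesianProductWith c xs ys (λ _ → 1) ⟩
  ∑ xs (λ _ → ∑ ys (λ _ → 1))                   ≡⟨ ∑-const xs _ ⟩
  length xs * ∑ ys (λ _ → 1)                    ≡⟨ cong (length xs *_) (∑-1 ys) ⟩
  length xs * length ys                         ∎
  where open ≡-Reasoning

-- Injectivity is asked for on `xs` alone, because the parametrisation in `thicken` is injective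
-- only over suitable point sets.
map-unique : {A B : Set} (f : A → B) {xs : List A} → (∀ {x y} → x ∈ xs → y ∈ xs → f x ≡ f y → x ≡ y) →
             Unique xs → Unique (map f xs)
map-unique f inj []           = []
map-unique f inj (x∉xs ∷ xs!) =
  All.map⁺ (All.tabulate λ y∈xs fx≡fy → All.lookup x∉xs y∈xs (inj (here refl) (there y∈xs) fx≡fy)) ∷
  map-unique f (λ x∈ y∈ → inj (there x∈) (there y∈)) xs!

-- Tuples with entries from a list.

module _ {A : Set} where

  -- The sample space of `k` independent choices from `L`, repetitions allowed; probabilities turn
  -- into sums over this list.
  tuples : List A → (k : ℕ) → List (Vec A k)
  tuples L zero    = [] ∷ []
  tuples L (suc k) = cartesianProductWith _∷_ L (tuples L k)

  length-tuples : (L : List A) (k : ℕ) → length (tuples L k) ≡ length L ^ k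
  length-tuples L zero    = refl
  length-tuples L (suc k) = trans (length-cartesianProductWith _∷_ L (tuples L k)) (cong (length L *_) (length-tuples L k))

  tuples-unique : {L : List A} → Unique L → (k : ℕ) → Unique (tuples L k)
  tuples-unique L! zero    = [] ∷ []
  tuples-unique L! (suc k) = Unique.cartesianProductWith⁺ _∷_ Vec.∷-injective L! (tuples-unique L! k)

  tuples-complete : {L : List A} → (∀ x → x ∈ L) → ∀ {k} (v : Vec A k) → v ∈ tuples L k
  tuples-complete all∈L []      = here refl
  tuples-complete all∈L (x ∷ v) = ∈-cartesianProductWith⁺ _∷_ (all∈L x) (tuples-complete all∈L v)

  tuples-⊆ : {L M : List A} → (∀ {x} → x ∈ L → x ∈ M) → ∀ k {v} → v ∈ tuples L k → v ∈ tuples M k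
  tuples-⊆ L⊆M zero    v∈ = v∈
  tuples-⊆ {L} L⊆M (suc k) v∈ with x , w , x∈ , w∈ , refl ← ∈-cartesianProductWith⁻ _∷_ L (tuples L k) v∈
    = ∈-cartesianProductWith⁺ _∷_ (L⊆M x∈) (tuples-⊆ L⊆M k w∈)

-- Vectors and hyperplanes over a finite field.

module Geometry (𝔽 : FiniteField) where

  open FiniteField 𝔽 public
    renaming (_+_ to infixl 6 _⊕_; _*_ to infixl 7 _⊗_; -_ to infix 8 ⊖_; _≟_ to infix 4 _≟ᶠ_; size to q)

  commutativeRing : CommutativeRing _ _
  commutativeRing = record { isCommutativeRing = isCommutativeRing }

  open CommutativeRing commutativeRing using ()
    renaming (+-identityˡ to ⊕-identityˡ; +-identityʳ to ⊕-identityʳ; -‿inverseʳ to ⊖-inverseʳ; +-assoc to ⊕-assoc; +-comm to ⊕-comm;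
              *-identityˡ to ⊗-identityˡ; *-identityʳ to ⊗-identityʳ; *-assoc to ⊗-assoc; *-comm to ⊗-comm; zeroˡ to ⊗-zeroˡ; zeroʳ to ⊗-zeroʳ)
  open RingProperties (CommutativeRing.ring commutativeRing) using (-1*x≈-x)
  open SemiringSolver (CommutativeRing.commutativeSemiring commutativeRing) using (solve; _:+_; _:*_; _:=_)

  0⊕a⊗0≡0 : ∀ a → 0# ⊕ a ⊗ 0# ≡ 0#
  0⊕a⊗0≡0 a = trans (⊕-identityˡ _) (⊗-zeroʳ a)

  ⊖-cancels : ∀ s → s ⊕ (⊖ 1#) ⊗ s ≡ 0#
  ⊖-cancels s = trans (cong (s ⊕_) (-1*x≈-x s)) (⊖-inverseʳ s)

  ⊗-cancelʳ : ∀ {a b c} → c ≢ 0# → a ⊗ c ≡ b ⊗ c → a ≡ b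
  ⊗-cancelʳ {a} {b} {c} c≢0 ac≡bc with c⁻¹ , cc⁻¹≡1 ← inverse c c≢0 = begin
    a              ≡⟨ ⊗-identityʳ a ⟨
    a ⊗ 1#         ≡⟨ cong (a ⊗_) cc⁻¹≡1 ⟨
    a ⊗ (c ⊗ c⁻¹)  ≡⟨ ⊗-assoc a c c⁻¹ ⟨
    a ⊗ c ⊗ c⁻¹    ≡⟨ cong (_⊗ c⁻¹) ac≡bc ⟩
    b ⊗ c ⊗ c⁻¹    ≡⟨ ⊗-assoc b c c⁻¹ ⟩
    b ⊗ (c ⊗ c⁻¹)  ≡⟨ cong (b ⊗_) cc⁻¹≡1 ⟩
    b ⊗ 1#         ≡⟨ ⊗-identityʳ b ⟩
    b              ∎
    where open ≡-Reasoning

  ⊕-cancelʳ : ∀ {a b} c → a ⊕ c ≡ b ⊕ c → a ≡ b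
  ⊕-cancelʳ {a} {b} c eq = trans (sym (back a c)) (trans (cong (_⊕ ⊖ c) eq) (back b c))
    where
    back : ∀ x y → x ⊕ y ⊕ ⊖ y ≡ x
    back x y = trans (⊕-assoc x y (⊖ y)) (trans (cong (x ⊕_) (⊖-inverseʳ y)) (⊕-identityʳ x))

  ⊕-cancelˡ : ∀ {a b} c → c ⊕ a ≡ c ⊕ b → a ≡ b
  ⊕-cancelˡ {a} {b} c eq = ⊕-cancelʳ c (trans (⊕-comm a c) (trans eq (⊕-comm c b)))

  1<q : 1 < q
  1<q = length-⊆ {xs = 0# ∷ 1# ∷ []} ((0≢1 ∷ []) ∷ [] ∷ []) λ {x} _ → complete x

  module _ {d : ℕ} where

    infixl 6 _+[_]_
    -- Serves both as translation along the direction `z` and, with `a` equal to `⊖ 1#`, as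
    -- subtraction, so that `·-linear` covers both.
    _+[_]_ : Vec Carrier d → Carrier → Vec Carrier d → Vec Carrier d
    x +[ a ] z = zipWith (λ s r → s ⊕ a ⊗ r) x z

    infix 4 _≟ᵛ_
    _≟ᵛ_ : DecidableEquality (Vec Carrier d)
    _≟ᵛ_ = Vec.≡-dec _≟ᶠ_

    𝟎 : Vec Carrier d
    𝟎 = replicate d 0#

  space : ∀ d → List (Vec Carrier d)
  space d = tuples elements d

  ∈-space : ∀ {d} (x : Vec Carrier d) → x ∈ space d
  ∈-space = tuples-complete complete

  space-unique : ∀ {d} → Unique (space d)
  space-unique {d} = tuples-unique distinct d

  length-space : ∀ {d} → length (space d) ≡ q ^ d
  length-space {d} = length-tuples elements d

  infixl 7 _·_
  _·_ : ∀ {d} → Vec Carrier d → Vec Carrier d → Carrier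
  _·_ = dot 𝔽

  ·-comm : ∀ {d} (x y : Vec Carrier d) → x · y ≡ y · x
  ·-comm []      []      = refl
  ·-comm (a ∷ x) (b ∷ y) = cong₂ _⊕_ (⊗-comm a b) (·-comm x y)

  ·-linear : ∀ {d} (x : Vec Carrier d) a z y → (x +[ a ] z) · y ≡ x · y ⊕ a ⊗ (z · y)
  ·-linear []      a []      []      = sym (0⊕a⊗0≡0 a)
  ·-linear (r ∷ x) a (s ∷ z) (b ∷ y) rewrite ·-linear x a z y = lemma r s a b (x · y) (z · y)
    where
    lemma : ∀ r s a b m n → (r ⊕ a ⊗ s) ⊗ b ⊕ (m ⊕ a ⊗ n) ≡ r ⊗ b ⊕ m ⊕ a ⊗ (s ⊗ b ⊕ n)
    lemma = solve 6 (λ r s a b m n → ((r :+ a :* s) :* b :+ (m :+ a :* n)) := (r :* b :+ m :+ a :* (s :* b :+ n))) refl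

  ·-zeroˡ : ∀ {d} (y : Vec Carrier d) → 𝟎 · y ≡ 0#
  ·-zeroˡ []      = refl
  ·-zeroˡ (b ∷ y) = trans (cong₂ _⊕_ (⊗-zeroˡ b) (·-zeroˡ y)) (⊕-identityʳ 0#)

  ·-zeroʳ : ∀ {d} (y : Vec Carrier d) → y · 𝟎 ≡ 0#
  ·-zeroʳ y = trans (·-comm y 𝟎) (·-zeroˡ y)

  -- The unit vector at the first coordinate where `y` and `w` differ separates them.
  ·-separates : ∀ {d} {y w : Vec Carrier d} → y ≢ w → ∃ λ u → u · y ≢ u · w
  ·-separates {y = []}    {[]}    y≢w = contradiction refl y≢w
  ·-separates {y = a ∷ y} {b ∷ w} y≢w with a ≟ᶠ b
  ... | no a≢b = 1# ∷ 𝟎 , λ eq → a≢b (trans (sym (unit a y)) (trans eq (unit b w)))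
    where
    unit : ∀ c v → (1# ∷ 𝟎) · (c ∷ v) ≡ c
    unit c v = trans (cong₂ _⊕_ (⊗-identityˡ c) (·-zeroˡ v)) (⊕-identityʳ c)
  ... | yes refl with u , uy≢uw ← ·-separates {y = y} {w} (λ y≡w → y≢w (cong (a ∷_) y≡w))
    = 0# ∷ u , λ eq → uy≢uw (⊕-cancelˡ (0# ⊗ a) eq)

  +[]-cancel : ∀ {d} a {x y : Vec Carrier d} z → x +[ a ] z ≡ y +[ a ] z → x ≡ y
  +[]-cancel a {[]}    {[]}    []      _  = refl
  +[]-cancel a {r ∷ x} {s ∷ y} (c ∷ z) eq with eq₁ , eq₂ ← Vec.∷-injective eq
    = cong₂ _∷_ (⊕-cancelʳ (a ⊗ c) eq₁) (+[]-cancel a z eq₂)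

  +[]-inverse : ∀ {d} (x : Vec Carrier d) a z → x +[ a ] z +[ ⊖ a ] z ≡ x
  +[]-inverse []      a []      = refl
  +[]-inverse (r ∷ x) a (c ∷ z) = cong₂ _∷_ (lemma r a c) (+[]-inverse x a z)
    where
    lemma : ∀ r a c → r ⊕ a ⊗ c ⊕ (⊖ a) ⊗ c ≡ r
    lemma r a c = trans (collect r a c (⊖ a)) (trans (cong (λ s → r ⊕ s ⊗ c) (⊖-inverseʳ a)) (trans (cong (r ⊕_) (⊗-zeroˡ c)) (⊕-identityʳ r)))
      where
      collect : ∀ r a c b → r ⊕ a ⊗ c ⊕ b ⊗ c ≡ r ⊕ (a ⊕ b) ⊗ c
      collect = solve 4 (λ r a c b → (r :+ a :* c :+ b :* c) := (r :+ (a :+ b) :* c)) refl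

  module _ {d : ℕ} where

    Linear : (Vec Carrier d → Carrier) → Set
    Linear φ = ∀ x a z → φ (x +[ a ] z) ≡ φ x ⊕ a ⊗ φ z

    -- The union of the lines in direction `z` through the points of `P`, listed with multiplicity.
    -- Comparing its length with that of a known list replaces every dimension count.
    thicken : List (Vec Carrier d) → Vec Carrier d → List (Vec Carrier d)
    thicken P z = map (λ (x , a) → x +[ a ] z) (cartesianProduct P elements)

    length-thicken : ∀ P z → length (thicken P z) ≡ length P * q
    length-thicken P z = trans (length-map _ (cartesianProduct P elements)) (length-cartesianProductWith _,_ P elements)

    ∈-thicken⁺ : ∀ {P x} z a → x ∈ P → x +[ a ] z ∈ thicken P z
    ∈-thicken⁺ z a x∈P = ∈-map⁺ (λ (x , a) → x +[ a ] z) (∈-cartesianProduct⁺ x∈P (complete a))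

    ∈-thicken⁻ : ∀ {P z v} → v ∈ thicken P z → ∃₂ λ x a → x ∈ P × v ≡ x +[ a ] z
    ∈-thicken⁻ {P} {z} v∈ with (x , a) , xa∈ , v≡ ← ∈-map⁻ (λ (x , a) → x +[ a ] z) v∈
      = x , a , proj₁ (∈-cartesianProduct⁻ P elements xa∈) , v≡

    -- As `φ` is constant on `P`, its value at `x +[ a ] z` determines `a`, and then `x` is
    -- recovered by cancelling the translation.
    thicken-unique : ∀ {P z φ e} → Linear φ → φ z ≢ 0# → (∀ {x} → x ∈ P → φ x ≡ e) → Unique P → Unique (thicken P z)
    thicken-unique {P} {z} {φ} {e} linear φz≢0 φ≡e P! = map-unique _ injective (Unique.cartesianProduct⁺ P! distinct)
      where
      injective : ∀ {xa yb} → xa ∈ cartesianProduct P elements → yb ∈ cartesianProduct P elements →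
                  proj₁ xa +[ proj₂ xa ] z ≡ proj₁ yb +[ proj₂ yb ] z → xa ≡ yb
      injective {x , a} {y , b} xa∈ yb∈ eq = cong₂ _,_ x≡y a≡b
        where
        value : ∀ {x a} → (x , a) ∈ cartesianProduct P elements → φ (x +[ a ] z) ≡ e ⊕ a ⊗ φ z
        value {x} {a} xa∈ = trans (linear x a z) (cong (_⊕ a ⊗ φ z) (φ≡e (proj₁ (∈-cartesianProduct⁻ P elements xa∈))))
        a≡b : a ≡ b
        a≡b = ⊗-cancelʳ φz≢0 (⊕-cancelˡ e (trans (sym (value xa∈)) (trans (cong φ eq) (value yb∈))))
        x≡y : x ≡ y
        x≡y = +[]-cancel b z (subst (λ s → x +[ s ] z ≡ y +[ b ] z) a≡b eq)

    length-≤-space : {P : List (Vec Carrier d)} → Unique P → length P ≤ q ^ d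
    length-≤-space P! = ≤-trans (length-⊆ P! λ {x} _ → ∈-space x) (≤-reflexive (length-space {d}))

    -- Any member `x₀` of `P` is a direction leaving the hyperplane, because `x₀ · y ≡ t` is
    -- nonzero; thickening along it yields distinct points of the space.
    hyperplane-≤ : ∀ {P y t} → t ≢ 0# → Unique P → (∀ {x} → x ∈ P → x · y ≡ t) → length P * q ≤ q ^ d
    hyperplane-≤ {[]}     _ _ _ = z≤n
    hyperplane-≤ {x₀ ∷ P} {y} {t} t≢0 P! ·y≡t = subst (_≤ q ^ d) (length-thicken (x₀ ∷ P) x₀)
      (length-≤-space (thicken-unique (λ x a z → ·-linear x a z y) (λ eq → t≢0 (trans (sym (·y≡t (here refl))) eq)) ·y≡t P!))

    -- Some direction `u` is not orthogonal to `x`, and every point can be slid along `u` onto the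
    -- hyperplane, so the thickened hyperplane covers the space.
    hyperplane-≥ : ∀ {x} t → x ≢ 𝟎 → q ^ d ≤ length (filter (λ y → x · y ≟ᶠ t) (space d)) * q
    hyperplane-≥ {x} t x≢0 with u , ux≢u0 ← ·-separates x≢0 = let open ≤-Reasoning in begin
      q ^ d                    ≡⟨ length-space {d} ⟨
      length (space d)       ≤⟨ length-⊆ space-unique (λ {v} _ → covered v) ⟩
      length (thicken H u)     ≡⟨ length-thicken H u ⟩
      length H * q             ∎
      where
      H : List (Vec Carrier d)
      H = filter (λ y → x · y ≟ᶠ t) (space d)
      ux≢0 : u · x ≢ 0#
      ux≢0 ux≡0 = ux≢u0 (trans ux≡0 (sym (·-zeroʳ u)))
      covered : ∀ v → v ∈ thicken H u
      covered v with r , uxr≡1 ← inverse (u · x) ux≢0 =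
        subst (_∈ thicken H u) (+[]-inverse v a u) (∈-thicken⁺ u (⊖ a) (∈-filter⁺ (λ y → x · y ≟ᶠ t) (∈-space _) on))
        where
        δ a : Carrier
        δ = t ⊕ ⊖ (v · x)
        -- Since `r` inverts `u · x`, moving `v` by `a` times `u` changes its product with `x` by
        -- exactly the deficit `δ`.
        a = δ ⊗ r
        rearrange : ∀ m δ r n → m ⊕ δ ⊗ r ⊗ n ≡ m ⊕ δ ⊗ (n ⊗ r)
        rearrange = solve 4 (λ m δ r n → (m :+ δ :* r :* n) := (m :+ δ :* (n :* r))) refl
        restore : δ ⊕ v · x ≡ t
        restore = trans (⊕-assoc t _ _) (trans (cong (t ⊕_) (trans (⊕-comm _ _) (⊖-inverseʳ (v · x)))) (⊕-identityʳ t))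
        open ≡-Reasoning
        on : x · (v +[ a ] u) ≡ t
        on = begin
          x · (v +[ a ] u)                           ≡⟨ ·-comm x _ ⟩
          (v +[ a ] u) · x                           ≡⟨ ·-linear v a u x ⟩
          v · x ⊕ δ ⊗ r ⊗ (u · x)                    ≡⟨ rearrange (v · x) δ r (u · x) ⟩
          v · x ⊕ δ ⊗ (u · x ⊗ r)                    ≡⟨ cong (λ s → v · x ⊕ δ ⊗ s) uxr≡1 ⟩
          v · x ⊕ δ ⊗ 1#                             ≡⟨ cong (v · x ⊕_) (⊗-identityʳ δ) ⟩
          v · x ⊕ (t ⊕ ⊖ (v · x))                    ≡⟨ ⊕-comm (v · x) δ ⟩
          t ⊕ ⊖ (v · x) ⊕ v · x                      ≡⟨ restore ⟩
          t                                          ∎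

    -- Translating by multiples of a member x₀ and of some u with u · y ≢ u · w keeps all points distinct:
    -- the values of · y − · w, then of · y, recover the two multiples.
    two-hyperplanes-≤ : ∀ {P y w t} → t ≢ 0# → y ≢ w → Unique P → (∀ {x} → x ∈ P → x · y ≡ t) →
                        (∀ {x} → x ∈ P → x · w ≡ t) → length P * q * q ≤ q ^ d
    two-hyperplanes-≤ {[]} _ _ _ _ _ = z≤n
    two-hyperplanes-≤ {P@(x₀ ∷ _)} {y} {w} {t} t≢0 y≢w P! ·y≡t ·w≡t with u , uy≢uw ← ·-separates y≢w = begin
      length P * q * q                        ≡⟨ cong (_* q) (length-thicken P x₀) ⟨
      length (thicken P x₀) * q               ≡⟨ length-thicken (thicken P x₀) u ⟨
      length (thicken (thicken P x₀) u)       ≤⟨ length-≤-space (thicken-unique φ-linear φu≢0 φ≡0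
                                                   (thicken-unique (λ x a z → ·-linear x a z y) x₀y≢0 ·y≡t P!)) ⟩
      q ^ d                                   ∎
      where
      open ≤-Reasoning
      φ : Vec Carrier d → Carrier
      φ x = x · y ⊕ (⊖ 1#) ⊗ (x · w)
      φ-linear : Linear φ
      φ-linear x a z rewrite ·-linear x a z y | ·-linear x a z w = lemma (x · y) (z · y) (x · w) (z · w) a (⊖ 1#)
        where
        lemma : ∀ m n o p a k → m ⊕ a ⊗ n ⊕ k ⊗ (o ⊕ a ⊗ p) ≡ m ⊕ k ⊗ o ⊕ a ⊗ (n ⊕ k ⊗ p)
        lemma = solve 6 (λ m n o p a k → (m :+ a :* n :+ k :* (o :+ a :* p)) := (m :+ k :* o :+ a :* (n :+ k :* p))) refl
      φu≢0 : φ u ≢ 0#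
      φu≢0 eq = uy≢uw (⊕-cancelʳ ((⊖ 1#) ⊗ (u · w)) (trans eq (sym (⊖-cancels (u · w)))))
      x₀y≢0 : x₀ · y ≢ 0#
      x₀y≢0 eq = t≢0 (trans (sym (·y≡t (here refl))) eq)
      φ≡0-on-P : ∀ {x} → x ∈ P → φ x ≡ 0#
      φ≡0-on-P x∈P = trans (cong₂ (λ m n → m ⊕ (⊖ 1#) ⊗ n) (·y≡t x∈P) (·w≡t x∈P)) (⊖-cancels t)
      φ≡0 : ∀ {v} → v ∈ thicken P x₀ → φ v ≡ 0#
      φ≡0 v∈ with x , a , x∈P , refl ← ∈-thicken⁻ {P = P} v∈ =
        trans (φ-linear x a x₀) (trans (cong₂ (λ m n → m ⊕ a ⊗ n) (φ≡0-on-P x∈P) (φ≡0-on-P (here refl))) (0⊕a⊗0≡0 a))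

-- Decisions, squares and a deviation inequality.

does-true⁻ : {P : Set} (P? : Dec P) → does P? ≡ true → P
does-true⁻ (yes p) _ = p

does-false⁻ : {P : Set} (P? : Dec P) → does P? ≡ false → ¬ P
does-false⁻ (no ¬p) _ = ¬p

𝟙-× : {P Q : Set} (P? : Dec P) (Q? : Dec Q) → 𝟙 P? * 𝟙 Q? ≡ 𝟙 (P? ×-dec Q?)
𝟙-× (yes _) (yes _) = refl
𝟙-× (yes _) (no _)  = refl
𝟙-× (no _)  _       = refl

∑-square : {A : Set} (xs : List A) (f : A → ℕ) → ∑ xs f * ∑ xs f ≡ ∑ xs (λ x → ∑ xs (λ y → f x * f y))
∑-square xs f = sym (trans (∑-cong xs λ x → ∑-*ˡ xs (f x) f) (∑-*ʳ xs (∑ xs f) f))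

-- The two sides differ by the square of the gap `e` between the smaller and the larger number.
2xy≤x²+y² : ∀ x y → 2 * (x * y) ≤ x * x + y * y
2xy≤x²+y² x y with ≤-total x y
... | inj₁ x≤y with e , refl ← m≤n⇒∃[o]m+o≡n x≤y = subst (2 * (x * (x + e)) ≤_) (lemma x e) (m≤m+n _ (e * e))
  where
  lemma : ∀ x e → 2 * (x * (x + e)) + e * e ≡ x * x + (x + e) * (x + e)
  lemma = solve-∀
... | inj₂ y≤x with e , refl ← m≤n⇒∃[o]m+o≡n y≤x = subst (2 * ((y + e) * y) ≤_) (lemma y e) (m≤m+n _ (e * e))
  where
  lemma : ∀ x e → 2 * ((x + e) * x) + e * e ≡ (x + e) * (x + e) + x * x
  lemma = solve-∀

-- (a − 2m)² ≥ m² [a < m], with the mixed term moved so that no subtraction occurs.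
deviation-bound : ∀ m a (a<m? : Dec (a < m)) → 4 * m * a + m * m * 𝟙 a<m? ≤ a * a + 4 * m * m
deviation-bound m a (yes a<m) with e , refl ← m≤n⇒∃[o]m+o≡n (<⇒≤ a<m) = subst (4 * (a + e) * a + (a + e) * (a + e) * 1 ≤_) (lemma a e) (m≤m+n _ (2 * a * e + 3 * e * e))
  where
  lemma : ∀ a e → 4 * (a + e) * a + (a + e) * (a + e) * 1 + (2 * a * e + 3 * e * e) ≡ a * a + 4 * (a + e) * (a + e)
  lemma = solve-∀
deviation-bound m a (no _) = subst₂ _≤_ (lemma₁ a m) (lemma₂ a m) (2xy≤x²+y² a (2 * m))
  where
  lemma₁ : ∀ a m → 2 * (a * (2 * m)) ≡ 4 * m * a + m * m * 0
  lemma₁ = solve-∀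
  lemma₂ : ∀ a m → a * a + 2 * m * (2 * m) ≡ a * a + 4 * m * m
  lemma₂ = solve-∀

-- The upper bound: independence and annihilators.

module Bounds (𝔽 : FiniteField) where

  open Geometry 𝔽

  instance
    q-nonZero : NonZero q
    q-nonZero = >-nonZero (<⇒≤ 1<q)

  module _ {d : ℕ} where

    -- Linear independence certified by a triangular dual system: each vector carries a `z` that
    -- detects it and kills all later ones.
    data Independent : List (Vec Carrier d) → Set where
      []  : Independent []
      _∷_ : ∀ {x C} → (∃ λ z → z · x ≢ 0# × All (λ c → z · c ≡ 0#) C) → Independent C → Independent (x ∷ C)

    annihilates? : ∀ C (v : Vec Carrier d) → Dec (All (λ c → v · c ≡ 0#) C)
    annihilates? C v = all? (λ c → v · c ≟ᶠ 0#) C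

    annihilator : List (Vec Carrier d) → List (Vec Carrier d)
    annihilator C = filter (annihilates? C) (space d)

    -- The witness `z` annihilates `C` but not `x`. Hence the annihilator of `x ∷ C`, thickened
    -- along `z`, stays without repetition inside that of `C`, which is therefore at least `q` times
    -- as large.
    annihilator-bound : ∀ {C} → Independent C → q ^ length C * length (annihilator C) ≤ q ^ d
    annihilator-bound {[]} [] = ≤-trans (≤-reflexive (*-identityˡ _)) (length-≤-space (Unique.filter⁺ (annihilates? []) space-unique))
    annihilator-bound {x ∷ C} ((z , zx≢0 , z⊥C) ∷ C-ind) = begin
      q * q ^ length C * length (annihilator (x ∷ C))     ≡⟨ lemma q (q ^ length C) _ ⟩
      q ^ length C * (length (annihilator (x ∷ C)) * q)   ≡⟨ cong (q ^ length C *_) (length-thicken (annihilator (x ∷ C)) z) ⟨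
      q ^ length C * length (thicken (annihilator (x ∷ C)) z)
        ≤⟨ *-monoʳ-≤ (q ^ length C) (length-⊆ thick! thick⊆) ⟩
      q ^ length C * length (annihilator C)               ≤⟨ annihilator-bound C-ind ⟩
      q ^ d                                               ∎
      where
      open ≤-Reasoning
      lemma : ∀ a b c → a * b * c ≡ b * (c * a)
      lemma = solve-∀
      ⊥∷ : ∀ {v} → v ∈ annihilator (x ∷ C) → All (λ c → v · c ≡ 0#) (x ∷ C)
      ⊥∷ v∈ = proj₂ (∈-filter⁻ (annihilates? (x ∷ C)) {xs = space d} v∈)
      thick! : Unique (thicken (annihilator (x ∷ C)) z)
      thick! = thicken-unique (λ v a w → ·-linear v a w x) zx≢0 (λ v∈ → All.head (⊥∷ v∈))
                 (Unique.filter⁺ (annihilates? (x ∷ C)) space-unique)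
      thick⊆ : ∀ {v} → v ∈ thicken (annihilator (x ∷ C)) z → v ∈ annihilator C
      thick⊆ v∈ with w , a , w∈ , refl ← ∈-thicken⁻ {P = annihilator (x ∷ C)} v∈ =
        ∈-filter⁺ (annihilates? C) (∈-space _) (All.zipWith (λ {c} (wc≡0 , zc≡0) →
          trans (·-linear w a z c) (trans (cong₂ (λ m n → m ⊕ a ⊗ n) wc≡0 zc≡0) (0⊕a⊗0≡0 a))) (All.tail (⊥∷ w∈) , z⊥C))

    -- Every annihilator contains `𝟎`, so `annihilator-bound` leaves `q ^ length C ≤ q ^ d`, and
    -- `1 < q` compares the exponents.
    independent-length : ∀ {C} → Independent C → length C ≤ d
    independent-length {C} C-ind = ≮⇒≥ λ d<∣C∣ → <⇒≱ (^-monoʳ-< q 1<q d<∣C∣) (begin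
      q ^ length C                              ≡⟨ *-identityʳ _ ⟨
      q ^ length C * 1                          ≤⟨ *-monoʳ-≤ (q ^ length C) nonempty ⟩
      q ^ length C * length (annihilator C)     ≤⟨ annihilator-bound C-ind ⟩
      q ^ d                                     ∎)
      where
      open ≤-Reasoning
      nonempty : 1 ≤ length (annihilator C)
      nonempty = length-⊆ {xs = 𝟎 ∷ []} ([] ∷ []) λ { (here refl) →
        ∈-filter⁺ (annihilates? C) (∈-space 𝟎) (All.tabulate λ {c} _ → ·-zeroˡ c) }

    -- The difference of a vector meeting every hyperplane of C except that of x and one meeting them all
    -- is orthogonal to C but not to x.
    shatters⇒independent : ∀ {t E C} → Unique C → Shatters 𝔽 t E C → Independent C
    shatters⇒independent {C = []} _ _ = []
    shatters⇒independent {t} {E} {x ∷ C} (x∉C ∷ C!) shatters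
      with y , _ , on ∷ ons ← shatters (λ _ → true)
         | w , _ , off ∷ ons′ ← shatters (λ c → not (does (c ≟ᵛ x)))
      = (w +[ ⊖ 1# ] y , z·x≢0 , All.tabulate z·c≡0) ∷
        shatters⇒independent C! λ f → let v , v∈E , all = shatters f in v , v∈E , All.tail all
      where
      z·c : ∀ c → (w +[ ⊖ 1# ] y) · c ≡ c · w ⊕ (⊖ 1#) ⊗ (c · y)
      z·c c = trans (·-linear w (⊖ 1#) y c) (cong₂ (λ m n → m ⊕ (⊖ 1#) ⊗ n) (·-comm w c) (·-comm y c))
      c·y≡t : ∀ {c} → c ∈ x ∷ C → c · y ≡ t
      c·y≡t {c} c∈ = does-true⁻ (c · y ≟ᶠ t) (All.lookup (on ∷ ons) c∈)
      x·w≢t : x · w ≢ t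
      x·w≢t = does-false⁻ (x · w ≟ᶠ t) (trans off (cong not (dec-true (x ≟ᵛ x) refl)))
      z·x≢0 : (w +[ ⊖ 1# ] y) · x ≢ 0#
      z·x≢0 eq = x·w≢t (⊕-cancelʳ ((⊖ 1#) ⊗ t)
        (trans (cong (λ s → x · w ⊕ (⊖ 1#) ⊗ s) (sym (c·y≡t (here refl)))) (trans (sym (z·c x)) (trans eq (sym (⊖-cancels t))))))
      z·c≡0 : ∀ {c} → c ∈ C → (w +[ ⊖ 1# ] y) · c ≡ 0#
      z·c≡0 {c} c∈C = trans (z·c c) (trans (cong₂ (λ m n → m ⊕ (⊖ 1#) ⊗ n) c·w≡t (c·y≡t (there c∈C))) (⊖-cancels t))
        where
        c·w≡t : c · w ≡ t
        c·w≡t = does-true⁻ (c · w ≟ᶠ t) (trans (All.lookup ons′ c∈C)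
          (cong not (dec-false (c ≟ᵛ x) λ c≡x → All.lookup x∉C c∈C (sym c≡x))))

  -- First and second moments of the incidence degrees.

  module Incidences {d : ℕ} {t : Carrier} (t≢0 : t ≢ 0#) where

    on? : (x y : Vec Carrier d) → Dec (x · y ≡ t)
    on? x y = x · y ≟ᶠ t

    incidence : Vec Carrier d → Vec Carrier d → ℕ
    incidence x y = 𝟙 (on? x y)

    -- For `x` equal to `𝟎` the product is never the nonzero `t`; the indicator term pays for this
    -- single exception.
    count-on-≥ : ∀ x → q ^ d ≤ q * ∑ (space d) (incidence x) + q ^ d * 𝟙 (x ≟ᵛ 𝟎)
    count-on-≥ x with x ≟ᵛ 𝟎
    ... | yes _  = ≤-trans (≤-reflexive (sym (*-identityʳ (q ^ d)))) (m≤n+m (q ^ d * 1) _)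
    ... | no x≢𝟎 = begin
      q ^ d                                           ≤⟨ hyperplane-≥ t x≢𝟎 ⟩
      length (filter (on? x) (space d)) * q               ≡⟨ cong (_* q) (length-filter-∑ (on? x) (space d)) ⟩
      ∑ (space d) (incidence x) * q                       ≡⟨ *-comm _ q ⟩
      q * ∑ (space d) (incidence x)                       ≤⟨ m≤m+n _ _ ⟩
      q * ∑ (space d) (incidence x) + q ^ d * 0           ∎
      where open ≤-Reasoning

    -- Off the diagonal `two-hyperplanes-≤` applies with `x` and `x′` as the two normals. On the
    -- diagonal only one hyperplane constrains `y`, which costs a further factor of `q`.
    count-common-≤ : ∀ x x′ → q * q * ∑ (space d) (λ y → incidence x y * incidence x′ y) ≤ q ^ d + q * q ^ d * 𝟙 (x ≟ᵛ x′)
    count-common-≤ x x′ = begin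
      q * q * ∑ (space d) (λ y → incidence x y * incidence x′ y)  ≡⟨ cong (q * q *_) (∑-cong (space d) λ y → 𝟙-× (on? x y) (on? x′ y)) ⟩
      q * q * ∑ (space d) (𝟙 ∘ both?)                              ≡⟨ cong (q * q *_) (length-filter-∑ both? (space d)) ⟨
      q * q * length Y                                         ≤⟨ bound ⟩
      q ^ d + q * q ^ d * 𝟙 (x ≟ᵛ x′)                          ∎
      where
      open ≤-Reasoning
      both? : ∀ y → Dec (x · y ≡ t × x′ · y ≡ t)
      both? y = on? x y ×-dec on? x′ y
      Y : List (Vec Carrier d)
      Y = filter both? (space d)
      Y! : Unique Y
      Y! = Unique.filter⁺ both? space-unique
      on : ∀ {y} → y ∈ Y → x · y ≡ t × x′ · y ≡ t
      on y∈ = proj₂ (∈-filter⁻ both? {xs = space d} y∈)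
      lemma : ∀ a b → a * a * b ≡ b * a * a
      lemma = solve-∀
      bound : q * q * length Y ≤ q ^ d + q * q ^ d * 𝟙 (x ≟ᵛ x′)
      bound with x ≟ᵛ x′
      ... | yes _ = begin
        q * q * length Y           ≡⟨ trans (*-assoc q q (length Y)) (cong (q *_) (*-comm q (length Y))) ⟩
        q * (length Y * q)         ≤⟨ *-monoʳ-≤ q (hyperplane-≤ t≢0 Y! λ y∈ → trans (·-comm _ x) (proj₁ (on y∈))) ⟩
        q * q ^ d                  ≡⟨ *-identityʳ _ ⟨
        q * q ^ d * 1              ≤⟨ m≤n+m _ (q ^ d) ⟩
        q ^ d + q * q ^ d * 1      ∎
      ... | no x≢x′ = begin
        q * q * length Y           ≡⟨ lemma q (length Y) ⟩
        length Y * q * q           ≤⟨ two-hyperplanes-≤ t≢0 x≢x′ Y! (λ y∈ → trans (·-comm _ x) (proj₁ (on y∈)))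
                                        (λ y∈ → trans (·-comm _ x′) (proj₂ (on y∈))) ⟩
        q ^ d                      ≤⟨ m≤m+n _ _ ⟩
        q ^ d + q * q ^ d * 0      ∎

    module _ {E : List (Vec Carrier d)} (E! : Unique E) where

      degree : Vec Carrier d → ℕ
      degree y = ∑ E (λ x → incidence x y)

      n : ℕ
      n = length E

      -- Double counting of incidences. The last summand allows for `𝟎`, which occurs in `E` at most
      -- once.
      ∑-degree-≥ : n * q ^ d ≤ q * ∑ (space d) degree + q ^ d
      ∑-degree-≥ = begin
        n * q ^ d                                                                ≡⟨ ∑-const E (q ^ d) ⟨
        ∑ E (λ _ → q ^ d)                                                        ≤⟨ ∑-mono E (λ {x} _ → count-on-≥ x) ⟩
        ∑ E (λ x → q * ∑ (space d) (incidence x) + q ^ d * 𝟙 (x ≟ᵛ 𝟎))              ≡⟨ ∑-+ E _ _ ⟩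
        ∑ E (λ x → q * ∑ (space d) (incidence x)) + ∑ E (λ x → q ^ d * 𝟙 (x ≟ᵛ 𝟎))  ≡⟨ cong₂ _+_ (∑-*ˡ E q _) (∑-*ˡ E (q ^ d) _) ⟩
        q * ∑ E (λ x → ∑ (space d) (incidence x)) + q ^ d * ∑ E (λ x → 𝟙 (x ≟ᵛ 𝟎))  ≤⟨ +-mono-≤ (≤-reflexive (cong (q *_) (∑-swap E (space d) incidence)))
                                                                                       (*-monoʳ-≤ (q ^ d) (∑-𝟙≤1 (_≟ᵛ 𝟎) E! λ _ _ x≡𝟎 y≡𝟎 → trans x≡𝟎 (sym y≡𝟎))) ⟩
        q * ∑ (space d) degree + q ^ d * 1                                           ≡⟨ cong (q * ∑ (space d) degree +_) (*-identityʳ _) ⟩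
        q * ∑ (space d) degree + q ^ d                                               ∎
        where open ≤-Reasoning

      -- A squared degree counts pairs `x`, `x′` in `E` whose hyperplanes both contain `y`.
      -- Exchanging the sums reduces it to `count-common-≤`, and each `x` has at most one diagonal
      -- partner.
      ∑-degree²-≤ : q * q * ∑ (space d) (λ y → degree y * degree y) ≤ n * (n * q ^ d + q * q ^ d)
      ∑-degree²-≤ = begin
        q * q * ∑ (space d) (λ y → degree y * degree y)
          ≡⟨ cong (q * q *_) (∑-cong (space d) λ y → ∑-square E _) ⟩
        q * q * ∑ (space d) (λ y → ∑ E (λ x → ∑ E (λ x′ → incidence x y * incidence x′ y)))
          ≡⟨ cong (q * q *_) (trans (∑-swap (space d) E _) (∑-cong E λ x → ∑-swap (space d) E _)) ⟩
        q * q * ∑ E (λ x → ∑ E (λ x′ → ∑ (space d) (λ y → incidence x y * incidence x′ y)))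
          ≡⟨ trans (sym (∑-*ˡ E (q * q) _)) (∑-cong E λ x → sym (∑-*ˡ E (q * q) _)) ⟩
        ∑ E (λ x → ∑ E (λ x′ → q * q * ∑ (space d) (λ y → incidence x y * incidence x′ y)))
          ≤⟨ ∑-mono E (λ {x} _ → ∑-mono E λ {x′} _ → count-common-≤ x x′) ⟩
        ∑ E (λ x → ∑ E (λ x′ → q ^ d + q * q ^ d * 𝟙 (x ≟ᵛ x′)))
          ≤⟨ ∑-mono E (λ {x} _ → row x) ⟩
        ∑ E (λ _ → n * q ^ d + q * q ^ d)
          ≡⟨ ∑-const E _ ⟩
        n * (n * q ^ d + q * q ^ d) ∎
        where
        open ≤-Reasoning
        row : ∀ x → ∑ E (λ x′ → q ^ d + q * q ^ d * 𝟙 (x ≟ᵛ x′)) ≤ n * q ^ d + q * q ^ d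
        row x = begin
          ∑ E (λ x′ → q ^ d + q * q ^ d * 𝟙 (x ≟ᵛ x′))                    ≡⟨ ∑-+ E _ _ ⟩
          ∑ E (λ _ → q ^ d) + ∑ E (λ x′ → q * q ^ d * 𝟙 (x ≟ᵛ x′))        ≡⟨ cong₂ _+_ (∑-const E _) (∑-*ˡ E (q * q ^ d) _) ⟩
          n * q ^ d + q * q ^ d * ∑ E (λ x′ → 𝟙 (x ≟ᵛ x′))
            ≤⟨ +-monoʳ-≤ (n * q ^ d) (*-monoʳ-≤ (q * q ^ d) (∑-𝟙≤1 (x ≟ᵛ_) E! λ _ _ x≡y x≡z → trans (sym x≡y) x≡z)) ⟩
          n * q ^ d + q * q ^ d * 1                                       ≡⟨ cong (n * q ^ d +_) (*-identityʳ _) ⟩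
          n * q ^ d + q * q ^ d                                           ∎

      -- The moments are taken over the whole space, where hyperplane sizes are known, while low
      -- degrees matter only in `E`; extending that nonnegative sum from `E` to the space only
      -- increases it.
      ∑-deviation : ∀ m → 4 * m * ∑ (space d) degree + m * m * ∑ E (λ y → 𝟙 (degree y <? m)) ≤
                          ∑ (space d) (λ y → degree y * degree y) + q ^ d * (4 * m * m)
      ∑-deviation m = begin
        4 * m * ∑ (space d) degree + m * m * ∑ E (λ y → 𝟙 (degree y <? m))
          ≤⟨ +-monoʳ-≤ (4 * m * ∑ (space d) degree) (*-monoʳ-≤ (m * m) (∑-⊆ _ E! λ {y} _ → ∈-space y)) ⟩
        4 * m * ∑ (space d) degree + m * m * ∑ (space d) (λ y → 𝟙 (degree y <? m))
          ≡⟨ cong₂ _+_ (∑-*ˡ (space d) (4 * m) _) (∑-*ˡ (space d) (m * m) _) ⟨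
        ∑ (space d) (λ y → 4 * m * degree y) + ∑ (space d) (λ y → m * m * 𝟙 (degree y <? m))
          ≡⟨ ∑-+ (space d) _ _ ⟨
        ∑ (space d) (λ y → 4 * m * degree y + m * m * 𝟙 (degree y <? m))
          ≤⟨ ∑-mono (space d) (λ {y} _ → deviation-bound m (degree y) (degree y <? m)) ⟩
        ∑ (space d) (λ y → degree y * degree y + 4 * m * m)
          ≡⟨ trans (∑-+ (space d) _ _) (cong (∑ (space d) (λ y → degree y * degree y) +_) (trans (∑-const (space d) _) (cong (_* (4 * m * m)) (length-space {d})))) ⟩
        ∑ (space d) (λ y → degree y * degree y) + q ^ d * (4 * m * m) ∎
        where open ≤-Reasoning

-- Tuples split by a Boolean pattern.

^-distribʳ-* : ∀ n a b → (a * b) ^ n ≡ a ^ n * b ^ n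
^-distribʳ-* zero    a b = refl
^-distribʳ-* (suc n) a b = trans (cong (a * b *_) (^-distribʳ-* n a b)) (lemma a b (a ^ n) (b ^ n))
  where
  lemma : ∀ a b c d → a * b * (c * d) ≡ a * c * (b * d)
  lemma = solve-∀

≤∑ : {A : Set} (f : A → ℕ) {x : A} {xs : List A} → x ∈ xs → f x ≤ ∑ xs f
≤∑ f (here refl)  = m≤m+n _ _
≤∑ f (there x∈xs) = ≤-trans (≤∑ f x∈xs) (m≤n+m _ _)

∈-take⁻ : {A : Set} (k : ℕ) {x : A} {xs : List A} → x ∈ take k xs → x ∈ xs
∈-take⁻ k = All.lookup (All.take⁺ k (All.tabulate id))

tuples-All : {A : Set} {L : List A} {P : A → Set} → (∀ {x} → x ∈ L → P x) → ∀ k {v} → v ∈ tuples L k → AllV.All P v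
tuples-All         p zero    {[]} _ = AllV.[]
tuples-All {L = L} p (suc k) v∈ with x , w , x∈ , w∈ , refl ← ∈-cartesianProductWith⁻ _∷_ L (tuples L k) v∈
  = p x∈ AllV.∷ tuples-All p k w∈

#true #false : ∀ {d} → Vec Bool d → ℕ
#true []           = 0
#true (true  ∷ S)  = suc (#true S)
#true (false ∷ S)  = #true S
#false []          = 0
#false (true  ∷ S) = #false S
#false (false ∷ S) = suc (#false S)

#true+#false : ∀ {d} (S : Vec Bool d) → #true S + #false S ≡ d
#true+#false []          = refl
#true+#false (true  ∷ S) = cong suc (#true+#false S)
#true+#false (false ∷ S) = trans (+-suc (#true S) (#false S)) (cong suc (#true+#false S))

-- Separates the two demands of a pattern: `z` holds the entries that must satisfy a condition, `u`
-- those that must violate it.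
merge : {A : Set} → ∀ {d} (S : Vec Bool d) → Vec A (#true S) → Vec A (#false S) → Vec A d
merge []          []      []      = []
merge (true  ∷ S) (x ∷ z) u       = x ∷ merge S z u
merge (false ∷ S) z       (x ∷ u) = x ∷ merge S z u

-- The coordinates are chosen independently, so those marked `true` may all be summed over before
-- the others.
∑-tuples-merge : {A : Set} (L : List A) → ∀ {d} (S : Vec Bool d) (f : Vec A d → ℕ) →
  ∑ (tuples L d) f ≡ ∑ (tuples L (#true S)) (λ z → ∑ (tuples L (#false S)) (λ u → f (merge S z u)))
∑-tuples-merge L [] f = sym (+-identityʳ _)
∑-tuples-merge L {suc d} (true ∷ S) f = begin
  ∑ (tuples L (suc d)) f                          ≡⟨ ∑-cartesianProductWith _∷_ L (tuples L d) f ⟩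
  ∑ L (λ x → ∑ (tuples L d) (λ v → f (x ∷ v)))    ≡⟨ ∑-cong L (λ x → ∑-tuples-merge L S (λ v → f (x ∷ v))) ⟩
  ∑ L (λ x → ∑ (tuples L (#true S)) (λ z → ∑ (tuples L (#false S)) (λ u → f (x ∷ merge S z u))))
    ≡⟨ ∑-cartesianProductWith _∷_ L (tuples L (#true S)) _ ⟨
  ∑ (tuples L (suc (#true S))) (λ z → ∑ (tuples L (#false S)) (λ u → f (merge (true ∷ S) z u))) ∎
  where open ≡-Reasoning
∑-tuples-merge L {suc d} (false ∷ S) f = begin
  ∑ (tuples L (suc d)) f                          ≡⟨ ∑-cartesianProductWith _∷_ L (tuples L d) f ⟩
  ∑ L (λ x → ∑ (tuples L d) (λ v → f (x ∷ v)))    ≡⟨ ∑-cong L (λ x → ∑-tuples-merge L S (λ v → f (x ∷ v))) ⟩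
  ∑ L (λ x → ∑ (tuples L (#true S)) (λ z → ∑ (tuples L (#false S)) (λ u → f (x ∷ merge S z u))))
    -- A coordinate marked `false` belongs to the inner tuple, so its sum has to pass inside the sum
    -- over `z`.
    ≡⟨ ∑-swap L (tuples L (#true S)) _ ⟩
  ∑ (tuples L (#true S)) (λ z → ∑ L (λ x → ∑ (tuples L (#false S)) (λ u → f (x ∷ merge S z u))))
    ≡⟨ ∑-cong (tuples L (#true S)) (λ z → sym (∑-cartesianProductWith _∷_ L (tuples L (#false S)) (λ u → f (merge (false ∷ S) z u)))) ⟩
  ∑ (tuples L (#true S)) (λ z → ∑ (tuples L (suc (#false S))) (λ u → f (merge (false ∷ S) z u))) ∎
  where open ≡-Reasoning

module _ {A : Set} {P : A → Set} (P? : Decidable P) where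

  hits : ∀ {k} → Vec A k → ℕ
  hits []      = 0
  hits (x ∷ v) = 𝟙 (P? x) + hits v

  -- Linearity of expectation: each of the `k` coordinates satisfies `P` with the frequency found in
  -- `L`. The factor `length L` on the left clears the denominator.
  ∑-hits : ∀ L k → length L * ∑ (tuples L k) hits ≡ k * ∑ L (𝟙 ∘ P?) * length L ^ k
  ∑-hits L zero    = *-zeroʳ (length L)
  ∑-hits L (suc k) = begin
    l * ∑ (tuples L (suc k)) hits                                   ≡⟨ cong (l *_) (∑-cartesianProductWith _∷_ L (tuples L k) hits) ⟩
    l * ∑ L (λ x → ∑ (tuples L k) (λ v → 𝟙 (P? x) + hits v))       ≡⟨ cong (l *_) (∑-cong L λ x → trans (∑-+ (tuples L k) _ _) (cong (_+ H) (∑-const (tuples L k) (𝟙 (P? x))))) ⟩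
    l * ∑ L (λ x → length (tuples L k) * 𝟙 (P? x) + H)              ≡⟨ cong (l *_) (trans (∑-+ L _ _) (cong₂ _+_ (∑-*ˡ L (length (tuples L k)) (𝟙 ∘ P?)) (∑-const L H))) ⟩
    l * (length (tuples L k) * c + l * H)                           ≡⟨ cong₂ (λ r s → l * (r * c + s)) (length-tuples L k) (∑-hits L k) ⟩
    l * (l ^ k * c + k * c * l ^ k)                                 ≡⟨ lemma l k c (l ^ k) ⟩
    suc k * c * l ^ suc k                                           ∎
    where
    open ≡-Reasoning
    l c H : ℕ
    l = length L
    c = ∑ L (𝟙 ∘ P?)
    H = ∑ (tuples L k) hits
    lemma : ∀ l k c r → l * (r * c + k * c * r) ≡ (1 + k) * c * (l * r)
    lemma = solve-∀

  does-merge : ∀ {d} (S : Vec Bool d) {z u} → AllV.All P z → hits u ≡ 0 → Vec.map (does ∘ P?) (merge S z u) ≡ S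
  does-merge [] {[]} {[]} _ _ = refl
  does-merge (true ∷ S) {x ∷ z} (px AllV.∷ pz) u≡0 = cong₂ _∷_ (dec-true (P? x) px) (does-merge S pz u≡0)
  does-merge (false ∷ S) {z} {x ∷ u} pz u≡0 = cong₂ _∷_ (dec-false (P? x) λ px → 1+n≢0 (trans (cong (_+ hits u) (sym (𝟙-yes (P? x) px))) u≡0))
    (does-merge S pz (m+n≡0⇒n≡0 (𝟙 (P? x)) u≡0))

-- Counting tuples with unrealised patterns.

module Search (𝔽 : FiniteField) {d : ℕ} {t : FiniteField.Carrier 𝔽} (t≢0 : t ≢ FiniteField.0# 𝔽)
  {E : List (Vec (FiniteField.Carrier 𝔽) d)} (E! : Unique E) (m : ℕ) where

  open Geometry 𝔽
  open Bounds 𝔽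
  open Incidences {d} t≢0

  V : Set
  V = Vec Carrier d

  trace : ∀ {k} → V → Vec V k → Vec Bool k
  trace w = Vec.map (λ x → does (on? x w))

  realised? : ∀ {k} (S : Vec Bool k) (xs : Vec V k) → Dec (Any (λ w → trace w xs ≡ S) E)
  realised? S xs = any? (λ w → Vec.≡-dec Bool._≟_ (trace w xs) S) E

  bad : ∀ {k} → Vec Bool k → Vec V k → ℕ
  bad S xs = 𝟙 (¬? (realised? S xs))

  -- If `u` has no hit, `w` itself realises `S`; otherwise the number of hits is at least 1 and
  -- bounds the indicator. This is the union bound over the entries of `u`.
  bad-merge : ∀ {k} (S : Vec Bool k) {w} z u → w ∈ E → AllV.All (λ x → x · w ≡ t) z → bad S (merge S z u) ≤ hits (λ x → on? x w) u
  bad-merge S {w} z u w∈E on with hits (λ x → on? x w) u in eq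
  ... | suc _ = ≤-trans (𝟙≤1 (¬? (realised? S (merge S z u)))) (s≤s z≤n)
  ... | zero  = ≤-reflexive (𝟙-no (¬? (realised? S (merge S z u))) λ unrealised →
                  unrealised (lose w∈E (does-merge (λ x → on? x w) S on eq)))

  -- Cut off at `m` so that every rich point offers the same number of tuples, which makes sums over
  -- points and tuples uniform averages.
  nbrs : V → List V
  nbrs y = take m (filter (λ x → on? x y) E)

  nbrs-unique : ∀ y → Unique (nbrs y)
  nbrs-unique y = Unique.take⁺ m (Unique.filter⁺ (λ x → on? x y) E!)

  nbrs-∈ : ∀ {y x} → x ∈ nbrs y → x ∈ E × x · y ≡ t
  nbrs-∈ {y} x∈ = ∈-filter⁻ (λ x → on? x y) (∈-take⁻ m x∈)

  rich? : (y : V) → Dec (m ≤ degree E! y)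
  rich? y = m ≤? degree E! y

  Y : List V
  Y = filter rich? E

  Y⊆E : ∀ {y} → y ∈ Y → y ∈ E
  Y⊆E y∈ = proj₁ (∈-filter⁻ rich? y∈)

  length-nbrs : ∀ {y} → y ∈ Y → length (nbrs y) ≡ m
  length-nbrs {y} y∈ = trans (length-take m _) (m≤n⇒m⊓n≡m
    (≤-trans (proj₂ (∈-filter⁻ rich? {xs = E} y∈)) (≤-reflexive (sym (length-filter-∑ (λ x → on? x y) E)))))

  All-on? : ∀ {a} (z : Vec V a) y → Dec (AllV.All (λ x → x · y ≡ t) z)
  All-on? z y = AllV.all? (λ x → on? x y) z

  other? : ∀ {a} (z : Vec V a) y → Dec (Any (λ w → y ≢ w × AllV.All (λ x → x · w ≡ t) z) E)
  other? z y = any? (λ w → ¬? (y ≟ᵛ w) ×-dec All-on? z w) E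

  sole? : ∀ {a} (z : Vec V a) y → Dec (AllV.All (λ x → x · y ≡ t) z × ¬ Any (λ w → y ≢ w × AllV.All (λ x → x · w ≡ t) z) E)
  sole? z y = All-on? z y ×-dec ¬? (other? z y)

  -- If two different points were incident with all of `z`, each would be the other point that
  -- `sole?` excludes.
  ∑-sole-≤1 : ∀ {a} (z : Vec V a) → ∑ Y (λ y → 𝟙 (sole? z y)) ≤ 1
  ∑-sole-≤1 z = ∑-𝟙≤1 (sole? z) (Unique.filter⁺ rich? E!) same
    where
    same : ∀ {y y′} → y ∈ Y → y′ ∈ Y → _ → _ → y ≡ y′
    same {y} {y′} _ y′∈ (_ , alone) (on , _) with y ≟ᵛ y′
    ... | yes y≡y′ = y≡y′
    ... | no  y≢y′ = contradiction (lose (Y⊆E y′∈) (y≢y′ , on)) alone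

  -- Each tuple `z` over `E` is charged to at most one point, so enlarging the range from neighbours
  -- of `y` to all of `E` bounds the total by the number of tuples.
  ∑∑-sole-≤ : ∀ a → ∑ Y (λ y → ∑ (tuples (nbrs y) a) (λ z → 𝟙 (sole? z y))) ≤ length E ^ a
  ∑∑-sole-≤ a = begin
    ∑ Y (λ y → ∑ (tuples (nbrs y) a) (λ z → 𝟙 (sole? z y)))
      ≤⟨ ∑-mono Y (λ {y} _ → ∑-⊆ _ (tuples-unique (nbrs-unique y) a) (tuples-⊆ (proj₁ ∘ nbrs-∈ {y}) a)) ⟩
    ∑ Y (λ y → ∑ (tuples E a) (λ z → 𝟙 (sole? z y)))   ≡⟨ ∑-swap Y (tuples E a) _ ⟩
    ∑ (tuples E a) (λ z → ∑ Y (λ y → 𝟙 (sole? z y)))   ≤⟨ ∑-mono (tuples E a) (λ {z} _ → ∑-sole-≤1 z) ⟩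
    ∑ (tuples E a) (λ _ → 1)                            ≡⟨ ∑-1 (tuples E a) ⟩
    length (tuples E a)                                 ≡⟨ length-tuples E a ⟩
    length E ^ a                                        ∎
    where open ≤-Reasoning

  module _ (B : ℕ) (qqB≡qᵈ : q * q * B ≡ q ^ d) where

    -- Here `B` plays the role of `q` to the power `d` minus 2, the size of an intersection of two
    -- hyperplanes; it is fixed by an equation so that no exponent is truncated.
    common-≤ : ∀ {y w} → y ≢ w → ∑ (nbrs y) (λ x → 𝟙 (on? x w)) ≤ B
    common-≤ {y} {w} y≢w = *-cancelˡ-≤ (q * q) {{m*n≢0 q q}} (begin
      q * q * ∑ (nbrs y) (λ x → 𝟙 (on? x w))  ≡⟨ cong (q * q *_) (length-filter-∑ (λ x → on? x w) (nbrs y)) ⟨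
      q * q * length P                        ≡⟨ trans (*-comm (q * q) (length P)) (sym (*-assoc (length P) q q)) ⟩
      length P * q * q                        ≤⟨ two-hyperplanes-≤ t≢0 y≢w (Unique.filter⁺ (λ x → on? x w) (nbrs-unique y))
                                                   (proj₂ ∘ nbrs-∈ {y} ∘ proj₁ ∘ split) (proj₂ ∘ split) ⟩
      q ^ d                                   ≡⟨ qqB≡qᵈ ⟨
      q * q * B                               ∎)
      where
      open ≤-Reasoning
      P : List V
      P = filter (λ x → on? x w) (nbrs y)
      split : ∀ {x} → x ∈ P → x ∈ nbrs y × x · w ≡ t
      split = ∈-filter⁻ (λ x → on? x w)

    -- For fixed `z` there are two cases. Without another point `w` incident with all of `z`, every
    -- completion `u` is charged to `sole?`. With such a `w`, a completion fails only if it hits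
    -- `w`, and `∑-hits` with `common-≤` makes that rare.
    ∑-bad-u : ∀ {k y} (S : Vec Bool k) z → y ∈ Y → z ∈ tuples (nbrs y) (#true S) →
      m * ∑ (tuples (nbrs y) (#false S)) (λ u → bad S (merge S z u)) ≤
      m * (m ^ #false S * 𝟙 (sole? z y)) + #false S * B * m ^ #false S
    ∑-bad-u {y = y} S z y∈ z∈ with other? z y
    ... | no none = begin
      m * ∑ (tuples L b) (λ u → bad S (merge S z u))  ≤⟨ *-monoʳ-≤ m (∑-mono (tuples L b) λ {u} _ → 𝟙≤1 (¬? (realised? S (merge S z u)))) ⟩
      m * ∑ (tuples L b) (λ _ → 1)                    ≡⟨ cong (m *_) (trans (∑-1 (tuples L b)) (trans (length-tuples L b) (cong (_^ b) (length-nbrs y∈)))) ⟩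
      m * m ^ b                                       ≡⟨ cong (m *_) (*-identityʳ _) ⟨
      m * (m ^ b * 1)                                 ≡⟨ cong (λ s → m * (m ^ b * s)) (𝟙-yes (All-on? z y ×-dec ¬? (no none)) (tuples-All (proj₂ ∘ nbrs-∈ {y}) _ z∈ , none)) ⟨
      m * (m ^ b * _)                                 ≤⟨ m≤m+n _ _ ⟩
      m * (m ^ b * _) + b * B * m ^ b                 ∎
      where
      open ≤-Reasoning
      L = nbrs y
      b = #false S
    ... | yes some with w , w∈E , y≢w , on ← find some = begin
      m * ∑ (tuples L b) (λ u → bad S (merge S z u))  ≤⟨ *-monoʳ-≤ m (∑-mono (tuples L b) λ {u} _ → bad-merge S z u w∈E on) ⟩
      m * ∑ (tuples L b) (hits (λ x → on? x w))       ≡⟨ subst (λ l → l * ∑ (tuples L b) (hits (λ x → on? x w)) ≡ b * ∑ L (λ x → 𝟙 (on? x w)) * l ^ b) (length-nbrs y∈) (∑-hits (λ x → on? x w) L b) ⟩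
      b * ∑ L (λ x → 𝟙 (on? x w)) * m ^ b             ≤⟨ *-monoˡ-≤ (m ^ b) (*-monoʳ-≤ b (common-≤ y≢w)) ⟩
      b * B * m ^ b                                   ≤⟨ m≤n+m _ _ ⟩
      m * (m ^ b * _) + b * B * m ^ b                 ∎
      where
      open ≤-Reasoning
      L = nbrs y
      b = #false S

    -- Summing over `z` recombines the powers of `m` into `m ^ k`, and bounding `#false S` by `k`
    -- makes the last summand the same for all patterns.
    ∑-bad : ∀ {k y} (S : Vec Bool k) → y ∈ Y →
      m * ∑ (tuples (nbrs y) k) (bad S) ≤
      m * (m ^ #false S * ∑ (tuples (nbrs y) (#true S)) (λ z → 𝟙 (sole? z y))) + k * B * m ^ k
    ∑-bad {k} {y} S y∈ = begin
      m * ∑ (tuples L k) (bad S)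
        ≡⟨ cong (m *_) (∑-tuples-merge L S (bad S)) ⟩
      m * ∑ (tuples L a) (λ z → ∑ (tuples L b) (λ u → bad S (merge S z u)))
        ≡⟨ ∑-*ˡ (tuples L a) m _ ⟨
      ∑ (tuples L a) (λ z → m * ∑ (tuples L b) (λ u → bad S (merge S z u)))
        ≤⟨ ∑-mono (tuples L a) (λ {z} z∈ → ∑-bad-u S z y∈ z∈) ⟩
      ∑ (tuples L a) (λ z → m * (m ^ b * 𝟙 (sole? z y)) + b * B * m ^ b)
        ≡⟨ trans (∑-+ (tuples L a) _ _) (cong₂ _+_ (trans (∑-*ˡ (tuples L a) m _) (cong (m *_) (∑-*ˡ (tuples L a) (m ^ b) _))) (∑-const (tuples L a) _)) ⟩
      m * (m ^ b * ∑ (tuples L a) (λ z → 𝟙 (sole? z y))) + length (tuples L a) * (b * B * m ^ b)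
        ≡⟨ cong (λ s → σ + s * (b * B * m ^ b)) (trans (length-tuples L a) (cong (_^ a) (length-nbrs y∈))) ⟩
      σ + m ^ a * (b * B * m ^ b)
        ≡⟨ cong (σ +_) (lemma (m ^ a) b B (m ^ b)) ⟩
      σ + b * B * (m ^ a * m ^ b)
        ≡⟨ cong (λ s → σ + b * B * s) (trans (sym (^-distribˡ-+-* m a b)) (cong (m ^_) (#true+#false S))) ⟩
      σ + b * B * m ^ k
        ≤⟨ +-monoʳ-≤ σ (*-monoˡ-≤ (m ^ k) (*-monoˡ-≤ B (subst (b ≤_) (#true+#false S) (m≤n+m b a)))) ⟩
      σ + k * B * m ^ k ∎
      where
      open ≤-Reasoning
      L = nbrs y
      a = #true S
      b = #false S
      σ = m * (m ^ b * ∑ (tuples L a) (λ z → 𝟙 (sole? z y)))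
      lemma : ∀ x b B y → x * (b * B * y) ≡ b * B * (x * y)
      lemma = solve-∀

    -- The point `y` realises this pattern itself. The case is kept apart because the count of
    -- `sole?` tuples would exceed the bound of `∑∑-bad` by a factor of `r`.
    ∑-bad-all-true : ∀ {k y} (S : Vec Bool k) → #false S ≡ 0 → y ∈ Y → ∑ (tuples (nbrs y) k) (bad S) ≤ 0
    ∑-bad-all-true {k} {y} S b≡0 y∈ = begin
      ∑ (tuples L k) (bad S)                                       ≡⟨ ∑-tuples-merge L S (bad S) ⟩
      ∑ (tuples L a) (λ z → ∑ (tuples L b) (λ u → bad S (merge S z u)))
        ≤⟨ ∑-mono (tuples L a) (λ {z} z∈ → ∑-mono (tuples L b) λ {u} _ →
             ≤-trans (bad-merge S z u (Y⊆E y∈) (tuples-All (proj₂ ∘ nbrs-∈ {y}) a z∈)) (≤-reflexive (no-hits b≡0 u))) ⟩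
      ∑ (tuples L a) (λ z → ∑ (tuples L b) (λ u → 0))              ≡⟨ ∑-cong (tuples L a) (λ _ → ∑-0 (tuples L b)) ⟩
      ∑ (tuples L a) (λ z → 0)                                     ≡⟨ ∑-0 (tuples L a) ⟩
      0                                                            ∎
      where
      open ≤-Reasoning
      L = nbrs y
      a = #true S
      b = #false S
      ∑-0 : {A : Set} (xs : List A) → ∑ xs (λ _ → 0) ≡ 0
      ∑-0 xs = trans (∑-const xs 0) (*-zeroʳ (length xs))
      no-hits : ∀ {j} → j ≡ 0 → (u : Vec V j) → hits (λ x → on? x y) u ≡ 0
      no-hits refl [] = refl

    -- With `r` the ratio of `length E` to `m`, the charge `m ^ b * length E ^ a` equals
    -- `m ^ suc k * r ^ a`. A pattern with some `false` entry has `a` at most `k`, which saves one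
    -- factor of `r`.
    ∑∑-bad : ∀ {k r} → length E ≡ r * m → 1 ≤ r → (S : Vec Bool (suc k)) →
      m * ∑ Y (λ y → ∑ (tuples (nbrs y) (suc k)) (bad S)) ≤ m * (m ^ suc k * r ^ k) + length Y * (suc k * B * m ^ suc k)
    ∑∑-bad {k} {r} ∣E∣≡rm 1≤r S with #false S in b≡
    ... | zero = begin
      m * ∑ Y (λ y → ∑ (tuples (nbrs y) (suc k)) (bad S))  ≤⟨ *-monoʳ-≤ m (∑-mono Y λ y∈ → ∑-bad-all-true S b≡ y∈) ⟩
      m * ∑ Y (λ y → 0)                                    ≡⟨ cong (m *_) (trans (∑-const Y 0) (*-zeroʳ (length Y))) ⟩
      m * 0                                                ≡⟨ *-zeroʳ m ⟩
      0                                                    ≤⟨ z≤n ⟩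
      m * (m ^ suc k * r ^ k) + length Y * (suc k * B * m ^ suc k) ∎
      where open ≤-Reasoning
    ... | suc b′ = begin
      m * ∑ Y (λ y → ∑ (tuples (nbrs y) (suc k)) (bad S))
        ≡⟨ ∑-*ˡ Y m _ ⟨
      ∑ Y (λ y → m * ∑ (tuples (nbrs y) (suc k)) (bad S))
        ≤⟨ ∑-mono Y (λ y∈ → ∑-bad S y∈) ⟩
      ∑ Y (λ y → m * (m ^ b * ∑ (tuples (nbrs y) a) (λ z → 𝟙 (sole? z y))) + suc k * B * m ^ suc k)
        ≡⟨ trans (∑-+ Y _ _) (cong₂ _+_ (trans (∑-*ˡ Y m _) (cong (m *_) (∑-*ˡ Y (m ^ b) _))) (∑-const Y _)) ⟩
      m * (m ^ b * ∑ Y (λ y → ∑ (tuples (nbrs y) a) (λ z → 𝟙 (sole? z y)))) + length Y * (suc k * B * m ^ suc k)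
        ≤⟨ +-monoˡ-≤ _ (*-monoʳ-≤ m (*-monoʳ-≤ (m ^ b) (∑∑-sole-≤ a))) ⟩
      m * (m ^ b * length E ^ a) + length Y * (suc k * B * m ^ suc k)
        ≡⟨ cong (λ s → m * s + length Y * (suc k * B * m ^ suc k)) power ⟩
      m * (m ^ suc k * r ^ a) + length Y * (suc k * B * m ^ suc k)
        ≤⟨ +-monoˡ-≤ _ (*-monoʳ-≤ m (*-monoʳ-≤ (m ^ suc k) (^-monoʳ-≤ r {{>-nonZero 1≤r}} a≤k))) ⟩
      m * (m ^ suc k * r ^ k) + length Y * (suc k * B * m ^ suc k) ∎
      where
      open ≤-Reasoning
      a = #true S
      b = #false S
      a+b≡1+k : a + b ≡ suc k
      a+b≡1+k = #true+#false S
      a≤k : a ≤ k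
      a≤k = ≤-pred (subst (suc a ≤_) a+b≡1+k (subst (λ s → suc a ≤ a + s) (sym b≡) (m<m+n a (s≤s z≤n))))
      lemma : ∀ x y z → x * (y * z) ≡ z * x * y
      lemma = solve-∀
      power : m ^ b * length E ^ a ≡ m ^ suc k * r ^ a
      power = begin-equality
        m ^ b * length E ^ a         ≡⟨ cong (λ s → m ^ b * s ^ a) ∣E∣≡rm ⟩
        m ^ b * (r * m) ^ a          ≡⟨ cong (m ^ b *_) (^-distribʳ-* a r m) ⟩
        m ^ b * (r ^ a * m ^ a)      ≡⟨ lemma (m ^ b) (r ^ a) (m ^ a) ⟩
        m ^ a * m ^ b * r ^ a        ≡⟨ cong (_* r ^ a) (trans (sym (^-distribˡ-+-* m a b)) (cong (m ^_) a+b≡1+k)) ⟩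
        m ^ suc k * r ^ a            ∎

    patterns : ∀ k → List (Vec Bool k)
    patterns = tuples (true ∷ false ∷ [])

    failures : ∀ {k} → Vec V k → ℕ
    failures {k} xs = ∑ (patterns k) (λ S → bad S xs)

    no-failures : ∀ {k} (xs : Vec V k) → failures xs < 1 → ∀ S → Any (λ w → trace w xs ≡ S) E
    no-failures xs none S = decidable-stable (realised? S xs) λ unrealised →
      <⇒≱ none (≤-trans (≤-reflexive (sym (𝟙-yes (¬? (realised? S xs)) unrealised)))
        (≤∑ (λ S → bad S xs) (tuples-complete (λ { true → here refl ; false → there (here refl) }) S)))

    ∑∑-failures : ∀ {k r} → length E ≡ r * m → 1 ≤ r →
      m * ∑ Y (λ y → ∑ (tuples (nbrs y) (suc k)) failures) ≤
      2 ^ suc k * (m * (m ^ suc k * r ^ k) + length Y * (suc k * B * m ^ suc k))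
    ∑∑-failures {k} {r} ∣E∣≡rm 1≤r = begin
      m * ∑ Y (λ y → ∑ (tuples (nbrs y) (suc k)) failures)
        ≡⟨ cong (m *_) (trans (∑-cong Y λ y → ∑-swap (tuples (nbrs y) (suc k)) (patterns (suc k)) (λ xs S → bad S xs)) (∑-swap Y (patterns (suc k)) _)) ⟩
      m * ∑ (patterns (suc k)) (λ S → ∑ Y (λ y → ∑ (tuples (nbrs y) (suc k)) (bad S)))
        ≡⟨ ∑-*ˡ (patterns (suc k)) m _ ⟨
      ∑ (patterns (suc k)) (λ S → m * ∑ Y (λ y → ∑ (tuples (nbrs y) (suc k)) (bad S)))
        ≤⟨ ∑-mono (patterns (suc k)) (λ {S} _ → ∑∑-bad ∣E∣≡rm 1≤r S) ⟩
      ∑ (patterns (suc k)) (λ _ → M)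
        ≡⟨ trans (∑-const (patterns (suc k)) M) (cong (_* M) (length-tuples (true ∷ false ∷ []) (suc k))) ⟩
      2 ^ suc k * M ∎
      where
      open ≤-Reasoning
      M = m * (m ^ suc k * r ^ k) + length Y * (suc k * B * m ^ suc k)

    -- Two averagings: some rich `y` has fewer failures in total than tuples, so one of its tuples
    -- has fewer than one failure.
    choose : ∀ {k r} → length E ≡ r * m → 1 ≤ r →
      2 ^ suc k * (m * (m ^ suc k * r ^ k) + length Y * (suc k * B * m ^ suc k)) < m * (length Y * m ^ suc k) →
      ∃ λ (xs : Vec V (suc k)) → AllV.All (_∈ E) xs × (∀ S → Any (λ w → trace w xs ≡ S) E)
    choose {k} {r} ∣E∣≡rm 1≤r few =
      let y  , y∈  , few-y = ∑-<⇒∃ Y {f = λ y → ∑ (tuples (nbrs y) (suc k)) failures} {λ _ → m ^ suc k}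
            (*-cancelˡ-< m _ _ (begin-strict
              m * ∑ Y (λ y → ∑ (tuples (nbrs y) (suc k)) failures)                            ≤⟨ ∑∑-failures ∣E∣≡rm 1≤r ⟩
              2 ^ suc k * (m * (m ^ suc k * r ^ k) + length Y * (suc k * B * m ^ suc k))      <⟨ few ⟩
              m * (length Y * m ^ suc k)                                                      ≡⟨ cong (m *_) (∑-const Y (m ^ suc k)) ⟨
              m * ∑ Y (λ _ → m ^ suc k)                                                       ∎))
          xs , xs∈ , none  = ∑-<⇒∃ (tuples (nbrs y) (suc k)) {f = failures} {λ _ → 1} (begin-strict
              ∑ (tuples (nbrs y) (suc k)) failures        <⟨ few-y ⟩
              m ^ suc k                                   ≡⟨ cong (_^ suc k) (length-nbrs y∈) ⟨
              length (nbrs y) ^ suc k                     ≡⟨ length-tuples (nbrs y) (suc k) ⟨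
              length (tuples (nbrs y) (suc k))            ≡⟨ ∑-1 (tuples (nbrs y) (suc k)) ⟨
              ∑ (tuples (nbrs y) (suc k)) (λ _ → 1)       ∎)
      in xs , tuples-All (proj₁ ∘ nbrs-∈ {y}) (suc k) xs∈ , no-failures xs none
      where open ≤-Reasoning

-- From a realised tuple to a shattered set.

toList-All : {A : Set} {P : A → Set} → ∀ {k} {v : Vec A k} → AllV.All P v → All P (toList v)
toList-All AllV.[]         = []
toList-All (px AllV.∷ pxs) = px ∷ toList-All pxs

map-≡⇒All : {A B : Set} {f g : A → B} → ∀ {k} (v : Vec A k) → Vec.map f v ≡ Vec.map g v → All (λ x → f x ≡ g x) (toList v)
map-≡⇒All []      _  = []
map-≡⇒All (x ∷ v) eq with eq₁ , eq₂ ← Vec.∷-injective eq = eq₁ ∷ map-≡⇒All v eq₂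

map-replicate⇒All : {A B : Set} {f : A → B} {b : B} → ∀ {k} (v : Vec A k) → Vec.map f v ≡ replicate k b → All (λ x → f x ≡ b) (toList v)
map-replicate⇒All []      _  = []
map-replicate⇒All (x ∷ v) eq with eq₁ , eq₂ ← Vec.∷-injective eq = eq₁ ∷ map-replicate⇒All v eq₂

-- Tuples may repeat entries, but realising `true` followed by `false` everywhere separates the head
-- from every later entry. The tail inherits all patterns by prefixing `true`.
separated⇒unique : {A B : Set} (h : B → A → Bool) → ∀ {k} (v : Vec A k) →
  (∀ S → ∃ λ w → Vec.map (h w) v ≡ S) → Unique (toList v)
separated⇒unique h []      _         = []
separated⇒unique h {suc k} (x ∷ v) separated with w , eq ← separated (true ∷ replicate k false) with eq₁ , eq₂ ← Vec.∷-injective eq =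
  All.map (λ off x≡x′ → contradiction (trans (sym eq₁) (trans (cong (h w) x≡x′) off)) λ ()) (map-replicate⇒All v eq₂) ∷
  separated⇒unique h v λ S → let w , eq = separated (true ∷ S) in w , Vec.∷-injectiveʳ eq

module _ (𝔽 : FiniteField) {d : ℕ} {t : FiniteField.Carrier 𝔽} {E : List (Vec (FiniteField.Carrier 𝔽) d)} where

  realised⇒shattered : ∀ {k} (xs : Vec (Vec (FiniteField.Carrier 𝔽) d) k) → AllV.All (_∈ E) xs →
    (∀ S → Any (λ w → Vec.map (h 𝔽 t w) xs ≡ S) E) →
    Σ (List (Vec (FiniteField.Carrier 𝔽) d)) λ C → Unique C × All (_∈ E) C × length C ≡ k × Shatters 𝔽 t E C
  realised⇒shattered xs xs∈E realised =
    toList xs ,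
    separated⇒unique (h 𝔽 t) xs (λ S → let w , _ , eq = find (realised S) in w , eq) ,
    toList-All xs∈E , Vec.length-toList xs ,
    λ f → let w , w∈E , eq = find (realised (Vec.map f xs)) in w , w∈E , map-≡⇒All xs eq

-- Numerical estimates.

^-cancelˡ-≤ : ∀ n .{{_ : NonZero n}} {a b} → a ^ n ≤ b ^ n → a ≤ b
^-cancelˡ-≤ n aⁿ≤bⁿ = ≮⇒≥ λ b<a → <⇒≱ (^-monoˡ-< n b<a) aⁿ≤bⁿ

𝟙-≤+𝟙-< : ∀ m a (m≤a? : Dec (m ≤ a)) (a<m? : Dec (a < m)) → 𝟙 m≤a? + 𝟙 a<m? ≡ 1
𝟙-≤+𝟙-< m a (yes m≤a) (yes a<m) = contradiction m≤a (<⇒≱ a<m)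
𝟙-≤+𝟙-< m a (yes _)   (no _)    = refl
𝟙-≤+𝟙-< m a (no _)    (yes _)   = refl
𝟙-≤+𝟙-< m a (no m≰a)  (no a≮m)  = contradiction (≮⇒≥ a≮m) m≰a

-- Chebyshev: D₁ and D₂ are the first and second moments of the degrees, whose mean is about 2m.
chebyshev : ∀ q B m D₁ D₂ ℓ .{{_ : NonZero q}} .{{_ : NonZero m}} → let n = 2 * q * m ; N = q * (q * B) in
  n * N ≤ q * D₁ + N → q * q * D₂ ≤ n * (n * N + q * N) → 4 * m * D₁ + m * m * ℓ ≤ D₂ + N * (4 * m * m) →
  m * ℓ ≤ 6 * (q * q * B)
chebyshev q B m D₁ D₂ ℓ first second deviation = *-cancelˡ-≤ (q * q * m) {{m*n≢0 (q * q) m {{m*n≢0 q q}}}} (+-cancelʳ-≤ (4 * m * q * (q * D₁ + N)) _ _ (begin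
  q * q * m * (m * ℓ) + 4 * m * q * (q * D₁ + N)            ≡⟨ lemma₁ q m D₁ ℓ N ⟩
  q * q * (4 * m * D₁ + m * m * ℓ) + 4 * m * q * N          ≤⟨ +-monoˡ-≤ _ (*-monoʳ-≤ (q * q) deviation) ⟩
  q * q * (D₂ + N * (4 * m * m)) + 4 * m * q * N            ≡⟨ lemma₂ q m D₂ N ⟩
  q * q * D₂ + (q * q * (N * (4 * m * m)) + 4 * m * q * N)  ≤⟨ +-monoˡ-≤ _ second ⟩
  n * (n * N + q * N) + (q * q * (N * (4 * m * m)) + 4 * m * q * N)  ≤⟨ +-monoʳ-≤ (n * (n * N + q * N)) (+-monoʳ-≤ _ (*-monoˡ-≤ N (m≤m*n (4 * m * q) q))) ⟩
  n * (n * N + q * N) + (q * q * (N * (4 * m * m)) + 4 * m * q * q * N)  ≡⟨ lemma₃ q m B ⟩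
  q * q * m * (6 * (q * q * B)) + 4 * m * q * (n * N)       ≤⟨ +-monoʳ-≤ (q * q * m * (6 * (q * q * B))) (*-monoʳ-≤ (4 * m * q) first) ⟩
  q * q * m * (6 * (q * q * B)) + 4 * m * q * (q * D₁ + N)  ∎))
  where
  open ≤-Reasoning
  n = 2 * q * m
  N = q * (q * B)
  lemma₁ : ∀ q m D₁ ℓ N → q * q * m * (m * ℓ) + 4 * m * q * (q * D₁ + N) ≡ q * q * (4 * m * D₁ + m * m * ℓ) + 4 * m * q * N
  lemma₁ = solve-∀
  lemma₂ : ∀ q m D₂ N → q * q * (D₂ + N * (4 * m * m)) + 4 * m * q * N ≡ q * q * D₂ + (q * q * (N * (4 * m * m)) + 4 * m * q * N)
  lemma₂ = solve-∀
  lemma₃ : ∀ q m B → 2 * q * m * (2 * q * m * (q * (q * B)) + q * (q * (q * B))) + (q * q * (q * (q * B) * (4 * m * m)) + 4 * m * q * q * (q * (q * B)))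
    ≡ q * q * m * (6 * (q * q * B)) + 4 * m * q * (2 * q * m * (q * (q * B)))
  lemma₃ = solve-∀

-- Meant for `K` the number of patterns, `R` the power of `r` from `∑∑-bad`, `y` the number of rich
-- points and `M` the number of tuples per point. After doubling, each of the two summands is
-- compared with `m * M * y`, the first one strictly.
few-failures : ∀ d P q B m y M {K R} .{{_ : NonZero d}} .{{_ : NonZero P}} .{{_ : NonZero q}} .{{_ : NonZero B}} .{{_ : NonZero M}} →
  K ≡ 2 * P → R ≡ P * (q * B) → m ≡ 8 * (P * P) * d * B → q * m ≤ y →
  K * (m * (M * R) + y * (d * B * M)) < m * (y * M)
few-failures d P q B m y M refl refl refl qm≤y = *-cancelˡ-< 2 _ _ (begin-strict
  2 * (2 * P * (m * (M * (P * (q * B))) + y * (d * B * M)))                ≡⟨ lemma₁ d P q B m y M ⟩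
  m * M * (4 * (P * P * q * B)) + 4 * (P * d * B) * (y * M)                <⟨ +-monoˡ-< _ (*-monoʳ-< (m * M) {{m*n≢0 m M}} small) ⟩
  m * M * y + 4 * (P * d * B) * (y * M)                                    ≤⟨ +-monoʳ-≤ (m * M * y) (*-monoˡ-≤ (y * M) 4PdB≤m) ⟩
  m * M * y + m * (y * M)                                                  ≡⟨ lemma₂ m M y ⟩
  2 * (m * (y * M))                                                        ∎)
  where
  open ≤-Reasoning
  instance
    m-nonZero : NonZero m
    m-nonZero = m*n≢0 (8 * (P * P) * d) B {{m*n≢0 (8 * (P * P)) d {{m*n≢0 8 (P * P) {{_}} {{m*n≢0 P P}}}}}}
  lemma₁ : ∀ d P q B m y M → 2 * (2 * P * (m * (M * (P * (q * B))) + y * (d * B * M))) ≡ m * M * (4 * (P * P * q * B)) + 4 * (P * d * B) * (y * M)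
  lemma₁ = solve-∀
  lemma₂ : ∀ m M y → m * M * y + m * (y * M) ≡ 2 * (m * (y * M))
  lemma₂ = solve-∀
  lemma₃ : ∀ d P q B → 8 * (P * P * q * B) * d ≡ q * (8 * (P * P) * d * B)
  lemma₃ = solve-∀
  lemma₄ : ∀ d P B → 4 * (P * d * B) * (2 * P) ≡ 8 * (P * P) * d * B
  lemma₄ = solve-∀
  small : 4 * (P * P * q * B) < y
  small = begin-strict
    -- Replacing 4 by 8 supplies the strictness and reaches the constant in `m`.
    4 * (P * P * q * B)       <⟨ *-monoˡ-< (P * P * q * B) {{m*n≢0 (P * P * q) B {{m*n≢0 (P * P) q {{m*n≢0 P P}}}}}} {4} {8} (m≤m+n 5 3) ⟩
    8 * (P * P * q * B)       ≤⟨ m≤m*n _ d ⟩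
    8 * (P * P * q * B) * d   ≡⟨ lemma₃ d P q B ⟩
    q * m                     ≤⟨ qm≤y ⟩
    y                         ∎
  4PdB≤m : 4 * (P * d * B) ≤ m
  4PdB≤m = ≤-trans (m≤m*n (4 * (P * d * B)) (2 * P) {{m*n≢0 2 P}}) (≤-reflexive (lemma₄ d P B))

6≤8P²d : ∀ P d .{{_ : NonZero P}} .{{_ : NonZero d}} → 6 ≤ 8 * (P * P) * d
6≤8P²d P d = ≤-trans (m≤m+n 6 2) (≤-trans (m≤m*n 8 (P * P) {{m*n≢0 P P}}) (m≤m*n (8 * (P * P)) d))

-- The lower bound for a set of exactly `2 * q * m` points.

module _ (𝔽 : FiniteField) {j : ℕ} {t : FiniteField.Carrier 𝔽} (t≢0 : t ≢ FiniteField.0# 𝔽)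
  {P c : ℕ} (P≡ : P ≡ 2 ^ suc (suc j)) (c≡ : c ≡ 8 * (P * P) * suc (suc (suc j))) where

  open Geometry 𝔽
  open Bounds 𝔽

  private
    k d B m : ℕ
    k = suc j
    d = suc (suc k)
    B = q ^ k
    m = c * B

    6≤c : 6 ≤ c
    6≤c = subst (6 ≤_) (sym c≡) (6≤8P²d P d {{subst NonZero (sym P≡) (m^n≢0 2 (suc k))}})

    instance
      P-nonZero : NonZero P
      P-nonZero = subst NonZero (sym P≡) (m^n≢0 2 (suc k))
      B-nonZero : NonZero B
      B-nonZero = m^n≢0 q k
      c-nonZero : NonZero c
      c-nonZero = >-nonZero (≤-trans (s≤s z≤n) 6≤c)
      m-nonZero : NonZero m
      m-nonZero = m*n≢0 c B

  module _ {E : List (Vec Carrier d)} (E! : Unique E) (∣E∣ : length E ≡ 2 * q * m) where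

    open Incidences {d} t≢0
    open Search 𝔽 t≢0 E! m

    poor : ℕ
    poor = ∑ E (λ y → 𝟙 (degree E! y <? m))

    rich+poor : length Y + poor ≡ q * m + q * m
    rich+poor = begin
      length Y + poor                                    ≡⟨ cong (_+ poor) (length-filter-∑ rich? E) ⟩
      ∑ E (𝟙 ∘ rich?) + poor                             ≡⟨ ∑-+ E _ _ ⟨
      ∑ E (λ y → 𝟙 (rich? y) + 𝟙 (degree E! y <? m))    ≡⟨ ∑-cong E (λ y → 𝟙-≤+𝟙-< m (degree E! y) (rich? y) (degree E! y <? m)) ⟩
      ∑ E (λ _ → 1)                                      ≡⟨ trans (∑-1 E) ∣E∣ ⟩
      2 * q * m                                          ≡⟨ lemma q m ⟩
      q * m + q * m                                      ∎
      where
      open ≡-Reasoning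
      lemma : ∀ q m → 2 * q * m ≡ q * m + q * m
      lemma = solve-∀

    -- `chebyshev` bounds `m * poor` by `6 * (q * q * B)`; as `c` is at least 6, cancelling `m`,
    -- which is `c * B`, leaves `q * q`.
    poor-bound : poor ≤ q * q
    poor-bound = *-cancelˡ-≤ (c * B) (begin
      m * poor           ≤⟨ chebyshev q B m (∑ (space d) (degree E!)) (∑ (space d) (λ y → degree E! y * degree E! y)) poor
                              (subst (λ n → n * q ^ d ≤ q * ∑ (space d) (degree E!) + q ^ d) ∣E∣ (∑-degree-≥ E!))
                              (subst (λ n → q * q * ∑ (space d) (λ y → degree E! y * degree E! y) ≤ n * (n * q ^ d + q * q ^ d)) ∣E∣ (∑-degree²-≤ E!))
                              (∑-deviation E! m) ⟩
      6 * (q * q * B)    ≤⟨ *-monoˡ-≤ (q * q * B) 6≤c ⟩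
      c * (q * q * B)    ≡⟨ lemma c q B ⟩
      c * B * (q * q)    ∎)
      where
      open ≤-Reasoning
      lemma : ∀ c q B → c * (q * q * B) ≡ c * B * (q * q)
      lemma = solve-∀

    rich-bound : q * m ≤ length Y
    rich-bound = +-cancelʳ-≤ (q * m) _ _ (begin
      q * m + q * m      ≡⟨ rich+poor ⟨
      length Y + poor    ≤⟨ +-monoʳ-≤ (length Y) (≤-trans poor-bound (*-monoʳ-≤ q q≤m)) ⟩
      length Y + q * m   ∎)
      where
      open ≤-Reasoning
      q≤m : q ≤ m
      -- As `d` is at least 3, `B` is `q * q ^ j` and hence at least `q`.
      q≤m = ≤-trans (m≤m*n q (q ^ j) {{m^n≢0 q j}}) (m≤n*m B c)

    shattered-tuple : ∃ λ (xs : Vec V d) → AllV.All (_∈ E) xs × (∀ S → Any (λ w → trace w xs ≡ S) E)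
    -- The ratio `r` is `2 * q`, so its power with exponent `suc k` is `P * (q * B)`, and the
    -- `2 ^ d` patterns number `2 * P`.
    shattered-tuple = choose B (*-assoc q q B) ∣E∣ (≤-trans (<⇒≤ 1<q) (m≤n*m q 2))
      (few-failures d P q B m (length Y) (m ^ d) {{_}} {{P-nonZero}} {{q-nonZero}} {{B-nonZero}} {{m^n≢0 m d}}
        (cong (2 *_) (sym P≡)) (trans (^-distribʳ-* (suc k) 2 q) (cong (_* q ^ suc k) (sym P≡))) (cong (_* B) c≡) rich-bound)

    shattered-list : Σ (List (Vec Carrier d)) λ C → Unique C × All (_∈ E) C × length C ≡ d × Shatters 𝔽 t E C
    shattered-list = let xs , xs∈E , realised = shattered-tuple in realised⇒shattered 𝔽 xs xs∈E realised

-- For d = j + 3 this is 8 · 4^(d−1) · d: summed over the 2^d patterns, tuples without w and tuples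
-- violating the proviso then each account for at most half of all choices, the former for strictly less.
constant : ℕ → ℕ
constant j = 8 * (2 ^ suc (suc j) * 2 ^ suc (suc j)) * suc (suc (suc j))

-- The size condition is the real inequality raised to the power `d ∸ 1`, which turns the fractional
-- exponent of `q` into the integer `d * (d ∸ 1) ∸ 1`.
theorem1p5 : (d : ℕ) → 3 ≤ d →
    Σ ℕ λ C → Σ ℕ λ Q →
    (𝔽 : FiniteField) → IsPrimePower (FiniteField.size 𝔽) → Q ≤ FiniteField.size 𝔽 →
    (t : FiniteField.Carrier 𝔽) → ¬ (t ≡ FiniteField.0# 𝔽) →
    (E : List (Vec (FiniteField.Carrier 𝔽) d)) → Unique E →
    C ^ (d ∸ 1) * FiniteField.size 𝔽 ^ (d * (d ∸ 1) ∸ 1) ≤ length E ^ (d ∸ 1) →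
    VCdimEq 𝔽 t E d
theorem1p5 d@(suc (suc (suc j))) (s≤s (s≤s (s≤s z≤n))) = 2 * constant j , 0 , λ 𝔽 _ _ t t≢0 E E! large →
  (let q = FiniteField.size 𝔽
       n = 2 * q * (constant j * q ^ suc j)
       -- The set found inside the first `n` points of `E` is shattered by points among them, and
       -- these lie in `E` as well.
       C , C! , C⊆ , ∣C∣ , shatters = shattered-list 𝔽 t≢0 refl refl (Unique.take⁺ n E!)
         (trans (length-take n E) (m≤n⇒m⊓n≡m (enough 𝔽 E large)))
   in C , C! , All.map (∈-take⁻ n) C⊆ , ∣C∣ , λ f → let w , w∈ , eq = shatters f in w , ∈-take⁻ n w∈ , eq) ,
  λ C C! _ shatters → let open Bounds 𝔽 in independent-length (shatters⇒independent C! shatters)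
  where
  k : ℕ
  k = suc j
  enough : ∀ 𝔽 (E : List (Vec (FiniteField.Carrier 𝔽) d)) → let q = FiniteField.size 𝔽 in
    (2 * constant j) ^ suc k * q ^ (d * suc k ∸ 1) ≤ length E ^ suc k → 2 * q * (constant j * q ^ k) ≤ length E
  enough 𝔽 E large = ^-cancelˡ-≤ (suc k) (begin
    (2 * q * (constant j * q ^ k)) ^ suc k                       ≡⟨ cong (_^ suc k) (lemma q (constant j) (q ^ k)) ⟩
    (2 * constant j * q ^ suc k) ^ suc k                         ≡⟨ ^-distribʳ-* (suc k) (2 * constant j) (q ^ suc k) ⟩
    (2 * constant j) ^ suc k * (q ^ suc k) ^ suc k               ≡⟨ cong ((2 * constant j) ^ suc k *_) (^-*-assoc q (suc k) (suc k)) ⟩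
    (2 * constant j) ^ suc k * q ^ (suc k * suc k)               ≤⟨ *-monoʳ-≤ ((2 * constant j) ^ suc k) (^-monoʳ-≤ q (m≤n+m (suc k * suc k) k)) ⟩
    (2 * constant j) ^ suc k * q ^ (d * suc k ∸ 1)               ≤⟨ large ⟩
    length E ^ suc k                                             ∎)
    where
    open ≤-Reasoning
    open Geometry 𝔽 using (q)
    open Bounds 𝔽 using (q-nonZero)
    lemma : ∀ q c B → 2 * q * (c * B) ≡ 2 * c * (q * B)
    lemma = solve-∀
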